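{- For every $n$, the map $\Phi_B$ is a bijection from $\mathcal{PT}_B(n)$ to $SP_{2n}$, the set of permutations $\pi$ of $\{1,\dots,2n\}$ satisfying $\pi_i+\pi_{2n+1-i}=2n+1$ for all $i$.
   Context: Let $F$ be a Ferrers diagram (left-justified rows of weakly decreasing lengths), empty rows and empty columns allowed, with $k$ columns and length $n$ = number of rows plus columns. The shifted diagram $\bar F$ is obtained by adding on top of $F$ $k$ new left-justified rows of lengths $1,\dots,k$ (top to bottom); the rightmost cells of the added rows are the diagonal cells. A type $B$ permutation tableau of length $n$ is a $0,1$-filling of such $\bar F$ such that (1) each column contains a $1$; (2) no $0$ has both a $1$ above it in its column and a $1$ to its left in its row; (3) a $0$ in a diagonal cell has no $1$ to its left in its row. $\mathcal{PT}_B(n)$ is the set of these. The symmetric tableau $T_s$ of $T$ is obtained by adjoining to $T$, for each non-diagonal cell, its mirror image with respect to the diagonal line (through the diagonal cells, running north-west to south-east), filled with the same entry; it is a filled Ferrers diagram of length $2n$. Label the $2n$ south-east boundary steps of $T_s$ by $1,\dots,2n$ from north-east to south-west; a row is labeled $i$ if its right-end vertical boundary step is labeled $i$, a column is labeled $j$ if its bottom horizontal boundary step is labeled $j$. For a label $i$, the zigzag path $P_i$ enters from the left of row $i$ (travelling east) or the top of column $i$ (travelling south) and moves east/south through cells, switching direction each time it meets a cell containing $1$, until it exits through a boundary step. $\Phi_B(T)$ is the permutation $\pi$ of $\{1,\dots,2n\}$ with $\pi_i$ the label of the boundary step of $T_s$ through which $P_i$ exits. -}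

module Defs where

open import Data.Nat using (ℕ; zero; suc; _+_; _*_; _∸_; _≤_; _<_; _<ᵇ_; _≤ᵇ_; _≡ᵇ_)
open import Data.Bool using (Bool; true; false; if_then_else_)
open import Data.List using (List; []; _∷_; length; map; upTo)
open import Data.Vec using (Vec; tabulate; toList; lookup)
open import Data.Fin using (Fin; toℕ; opposite)
open import Data.Product using (_×_; ∃)
open import Data.Maybe using (Maybe; just; nothing)
open import Relation.Nullary using (¬_)
open import Relation.Binary.PropositionalEquality using (_≡_)
open import Data.List.Relation.Binary.Permutation.Propositional using (_↭_)

-- Raw data of a (0,1)-filled shifted diagram  F̄.
-- Rows of F̄ are listed top to bottom (0-based index a), each row is the
-- list of its entries left to right (0-based column index b).
-- The first k rows are the added staircase rows (lengths 1..k);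
-- the remaining rows are the rows of F (k columns, weakly decreasing,
-- possibly empty).  Number of rows of F̄ = k + #rows(F) = length n.

record Tab : Set where
  constructor mkTab
  field
    k    : ℕ
    rows : List (List Bool)
open Tab public

nth : {A : Set} → A → List A → ℕ → A
nth d []       _       = d
nth d (x ∷ xs) zero    = x
nth d (x ∷ xs) (suc i) = nth d xs i

row : Tab → ℕ → List Bool
row T a = nth [] (rows T) a

rowLen : Tab → ℕ → ℕ
rowLen T a = length (row T a)

-- entry of cell (a , b); false outside the diagram
entry : Tab → ℕ → ℕ → Bool
entry T a b = nth false (row T a) b

record IsPTB (n : ℕ) (T : Tab) : Set where
  field
    nrows     : length (rows T) ≡ n
    k≤n       : k T ≤ n
    stair     : ∀ a → a < k T → rowLen T a ≡ suc a
    Fbounded  : ∀ a → k T ≤ a → a < n → rowLen T a ≤ k T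
    Fdecr     : ∀ a → k T ≤ a → suc a < n → rowLen T (suc a) ≤ rowLen T a
    colOne    : ∀ j → j < k T → ∃ λ i → (j < rowLen T i) × (entry T i j ≡ true)
    noLe      : ∀ i j → j < rowLen T i → entry T i j ≡ false →
                ¬ ((∃ λ i' → (i' < i) × (entry T i' j ≡ true)) ×
                   (∃ λ j' → (j' < j) × (entry T i j' ≡ true)))
    diag      : ∀ i → i < k T → entry T i i ≡ false →
                ¬ (∃ λ j → (j < i) × (entry T i j ≡ true))

-- The symmetric tableau T_s (cells in an n × n box, 0-based)

countB : (ℕ → Bool) → List ℕ → ℕ
countB p []       = 0
countB p (x ∷ xs) = if p x then suc (countB p xs) else countB p xs

-- row length of T_s: cells of row a of F̄ plus mirrors of cells (b , a), b > a
sRowLen : ℕ → Tab → ℕ → ℕ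
sRowLen n T a = rowLen T a + countB (λ b → a <ᵇ rowLen T b)
                                     (map (λ t → suc a + t) (upTo (n ∸ suc a)))

sColLen : ℕ → Tab → ℕ → ℕ
sColLen n T c = countB (λ a → c <ᵇ sRowLen n T a) (upTo n)

inS : ℕ → Tab → ℕ → ℕ → Bool
inS n T a b = b <ᵇ sRowLen n T a

entryS : Tab → ℕ → ℕ → Bool
entryS T a b = if b ≤ᵇ a then entry T a b else entry T b a

-- labels of the boundary steps (1..2n, from north-east to south-west)
-- row a (0-based): (n ∸ μ_a) west steps and a south steps precede it
rowLabel : ℕ → Tab → ℕ → ℕ
rowLabel n T a = suc ((n ∸ sRowLen n T a) + a)

-- column c (0-based, i.e. the (c+1)-st column): its bottom step is preceded
-- by (n ∸ (c+1)) west steps and (column length) south steps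
colLabel : ℕ → Tab → ℕ → ℕ
colLabel n T c = suc ((n ∸ suc c) + sColLen n T c)

data Dir : Set where
  east south : Dir

flip : Dir → Dir
flip east  = south
flip south = east

-- walk with fuel (each step increases a + b, so 2n+1 steps suffice);
-- returns the label of the exit boundary step
walk : ℕ → Tab → ℕ → Dir → ℕ → ℕ → ℕ
walk n T zero     d     a b = 0
walk n T (suc f)  d     a b with inS n T a b
walk n T (suc f)  east  a b | false = rowLabel n T a
walk n T (suc f)  south a b | false = colLabel n T b
walk n T (suc f)  d     a b | true with (if entryS T a b then flip d else d)
... | east  = walk n T f east  a (suc b)
... | south = walk n T f south (suc a) b

findIdx : (ℕ → Bool) → List ℕ → Maybe ℕ
findIdx p []       = nothing
findIdx p (x ∷ xs) = if p x then just x else findIdx p xs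

pathExit : ℕ → Tab → ℕ → ℕ
pathExit n T i with findIdx (λ a → rowLabel n T a ≡ᵇ i) (upTo n)
... | just a  = walk n T (suc (2 * n)) east a 0
... | nothing with findIdx (λ c → colLabel n T c ≡ᵇ i) (upTo n)
...   | just c  = walk n T (suc (2 * n)) south 0 c
...   | nothing = 0

ΦB : (n : ℕ) → Tab → Vec ℕ (2 * n)
ΦB n T = tabulate (λ i → pathExit n T (suc (toℕ i)))

record IsSP (n : ℕ) (π : Vec ℕ (2 * n)) : Set where
  field
    perm : toList π ↭ map suc (upTo (2 * n))
    symm : ∀ (i : Fin (2 * n)) → lookup π i + lookup π (opposite i) ≡ suc (2 * n)

{-# OPTIONS --safe #-}
-- Fill the cells of the n × n box outside T_s with 0: the zigzag paths then run
-- along 2n wires, one per row and one per column, and every cell containing 1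
-- swaps the paths on its two wires.  A path that has left its own wire never
-- returns to it, so condition (2) says that a cell of the shape contains 0 iff,
-- behind it, its row or its column still carries its own path.  Hence the exits
-- determine the filling of a given shape cell by cell, starting from the
-- south-east.  Conversely, undoing swaps by this rule from any exit assignment
-- compatible with the order of the labels ends at an assignment in which no
-- wire carries a later one; by injectivity it is the identity.
-- The shape is read off π: i labels a row iff i < π i, or i = π i and n < i,
-- the fixed points on rows coming from the empty rows of F.  The transpose of a
-- filling for a symmetric π has the same exits, so by uniqueness the filling is
-- symmetric and restricts to a type B tableau.
module Submission where

open import Defs
open import Data.Nat
open import Data.Nat.Properties
open import Data.Nat.Induction using (<-rec)
open import Data.Bool using (Bool; true; false; if_then_else_; _∧_)
open import Data.Bool.Properties using (¬-not; T-≡)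
open import Data.Fin as Fin using (Fin; toℕ; fromℕ<; opposite)
import Data.Fin.Properties as Fin
open import Data.List using (List; []; _∷_; _++_; length; map; upTo; applyUpTo; filter)
open import Data.List.Properties using (map-upTo; length-applyUpTo; length-map; length-++)
open import Data.List.Membership.Propositional using (_∈_)
open import Data.List.Membership.Propositional.Properties
  using (∈-upTo⁺; ∈-upTo⁻; ∈-applyUpTo⁺; ∈-applyUpTo⁻; ∈-filter⁺; ∈-filter⁻; ∈-++⁻; ∈-++⁺ˡ; ∈-++⁺ʳ;
      ∈-map⁺; ∈-map⁻)
open import Data.List.Membership.Propositional.Properties.WithK using (unique∧set⇒bag)
import Data.List.Relation.Unary.All as All
open import Data.List.Relation.Unary.Any using (here; there)
open import Data.List.Relation.Unary.AllPairs as AllPairs using (AllPairs; []; _∷_)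
import Data.List.Relation.Unary.AllPairs.Properties as AllPairs
open import Data.List.Relation.Unary.Unique.Propositional using (Unique)
import Data.List.Relation.Unary.Unique.Propositional.Properties as Unique
open import Data.List.Relation.Binary.BagAndSetEquality using (∼bag⇒↭)
open import Data.List.Relation.Binary.Permutation.Propositional using (_↭_; ↭-sym; ↭⇒↭ₛ)
open import Data.List.Relation.Binary.Permutation.Propositional.Properties using (↭-length; ∈-resp-↭)
import Data.List.Relation.Binary.Permutation.Setoid.Properties as PermutationSetoid
open import Data.Maybe using (just; nothing)
open import Data.Product using (_×_; ∃; _,_; proj₁; proj₂)
open import Data.Sum using (_⊎_; inj₁; inj₂)
open import Data.Vec using (Vec; _∷_; tabulate; toList; lookup)
open import Data.Vec.Properties using (lookup∘tabulate; tabulate-cong; tabulate∘lookup; length-toList)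
open import Function using (_∘_; id; Equivalence; mk⇔)
open import Relation.Nullary using (¬_; Dec; yes; no; contradiction; does)
open import Relation.Nullary.Decidable using (map′; dec-true; _⊎-dec_; _×-dec_)
open import Relation.Binary.Definitions using (tri<; tri≈; tri>)
open import Relation.Binary.PropositionalEquality

-- Condition (3) is what makes condition (2) hold in all of T_s: a 1 to the left of a diagonal cell
-- reappears above it, so that the diagonal cell cannot be 0. Condition (1) settles the fixed
-- points: for `j < k` column `j` of `T` contains a 1, so row `j` and column `j` of T_s both do, and
-- a path can stay on its own row only if the index of the row is at least `k`. Such a row stops
-- short of the diagonal, so its label exceeds `n`; this is the source of the tie-break `n < i`. The
-- wires are read against the direction of the paths: `hor` and `ver` give the start of the path on
-- an edge, so what appears at the sides of the box is the inverse of `ΦB`. This makes both halves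
-- of the argument local: a swap is invertible, so the starts on the two edges leaving a cell,
-- together with the bit in the cell, give the starts on the two edges entering it.

-- Counting, searching and finite sets of numbers.

<ᵇ-true : ∀ {a b} → a < b → (a <ᵇ b) ≡ true
<ᵇ-true = Equivalence.to T-≡ ∘ <⇒<ᵇ

<ᵇ-true⁻ : ∀ {a b} → (a <ᵇ b) ≡ true → a < b
<ᵇ-true⁻ = <ᵇ⇒< _ _ ∘ Equivalence.from T-≡

true≢false : ∀ {x} → x ≡ true → ¬ x ≡ false
true≢false refl ()

bool-ext : ∀ {x y} → (x ≡ true → y ≡ true) → (y ≡ true → x ≡ true) → x ≡ y
bool-ext {false} {false} f g = refl
bool-ext {false} {true}  f g = g refl
bool-ext {true}  {y}     f g = sym (f refl)

<-ext : ∀ {x y} → (∀ t → t < x → t < y) → (∀ t → t < y → t < x) → x ≡ y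
<-ext f g = ≤-antisym (≮⇒≥ (λ y<x → <-irrefl refl (f _ y<x)))
                      (≮⇒≥ (λ x<y → <-irrefl refl (g _ x<y)))

search : (p : ℕ → Bool) (m : ℕ) →
  (∃ λ i → i < m × p i ≡ true) ⊎ (∀ i → i < m → p i ≡ false)
search p zero = inj₂ (λ i ())
search p (suc m) with p m in eq | search p m
... | true  | _ = inj₁ (m , n<1+n m , eq)
... | false | inj₁ (i , i<m , q) = inj₁ (i , m<n⇒m<1+n i<m , q)
... | false | inj₂ none = inj₂ below
  where
    below : ∀ i → i < suc m → p i ≡ false
    below i i<1+m with m≤n⇒m<n∨m≡n (s≤s⁻¹ i<1+m)
    ... | inj₁ i<m  = none i i<m
    ... | inj₂ refl = eq

countB-≤ : ∀ p (f : ℕ → ℕ) m → countB p (applyUpTo f m) ≤ m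
countB-≤ p f zero = z≤n
countB-≤ p f (suc m) with p (f 0)
... | true  = s≤s (countB-≤ p (f ∘ suc) m)
... | false = m≤n⇒m≤1+n (countB-≤ p (f ∘ suc) m)

module _ (p : ℕ → Bool) where

  private
    Initial : (ℕ → ℕ) → ℕ → Set
    Initial f m = ∀ t → suc t < m → p (f (suc t)) ≡ true → p (f t) ≡ true

    initial-zero : ∀ f m → Initial f m → ∀ t → t < m → p (f t) ≡ true → p (f 0) ≡ true
    initial-zero f m ini zero    _ eq = eq
    initial-zero f m ini (suc t) l eq =
      initial-zero f m ini t (<-trans (n<1+n t) l) (ini t l eq)

    initial-tail : ∀ f m → Initial f (suc m) → Initial (f ∘ suc) m
    initial-tail f m ini t l = ini (suc t) (s≤s l)

  -- When `p` holds on an initial segment of the list, its count is the length of that segment. The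
  -- row and column lengths of T_s involve such counts, so this and its converse turn a bound on a
  -- length into membership of a single cell.
  countB-initial⁻ : ∀ f m → Initial f m → ∀ t → t < countB p (applyUpTo f m) →
    t < m × p (f t) ≡ true
  countB-initial⁻ f (suc m) ini t l with p (f 0) in eq
  countB-initial⁻ f (suc m) ini zero l | true = z<s , eq
  countB-initial⁻ f (suc m) ini (suc t) l | true
    with countB-initial⁻ (f ∘ suc) m (initial-tail f m ini) t (s≤s⁻¹ l)
  ... | t<m , q = s≤s t<m , q
  countB-initial⁻ f (suc m) ini t l | false
    with countB-initial⁻ (f ∘ suc) m (initial-tail f m ini) t l
  ... | t<m , q = contradiction eq (true≢false (initial-zero f (suc m) ini (suc t) (s≤s t<m) q))

  countB-initial⁺ : ∀ f m → Initial f m → ∀ t → t < m → p (f t) ≡ true →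
    t < countB p (applyUpTo f m)
  countB-initial⁺ f (suc m) ini t l q with p (f 0) in eq
  countB-initial⁺ f (suc m) ini zero l q | true = z<s
  countB-initial⁺ f (suc m) ini (suc t) l q | true =
    s≤s (countB-initial⁺ (f ∘ suc) m (initial-tail f m ini) t (s≤s⁻¹ l) q)
  ... | false = contradiction eq (true≢false (initial-zero f (suc m) ini t l q))

findIdx-just : ∀ p xs {x} → findIdx p xs ≡ just x → x ∈ xs × p x ≡ true
findIdx-just p (y ∷ xs) eq with p y in py
findIdx-just p (y ∷ xs) refl | true = here refl , py
... | false with findIdx-just p xs eq
... | x∈ , px = there x∈ , px

findIdx-nothing : ∀ p xs → findIdx p xs ≡ nothing → ∀ {x} → x ∈ xs → p x ≡ false
findIdx-nothing p (y ∷ xs) eq x∈ with p y in py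
findIdx-nothing p (y ∷ xs) eq (here refl) | false = py
findIdx-nothing p (y ∷ xs) eq (there x∈)  | false = findIdx-nothing p xs eq x∈

module _ {A : Set} (d : A) where

  nth-default : ∀ xs i → length xs ≤ i → nth d xs i ≡ d
  nth-default []       i       _       = refl
  nth-default (x ∷ xs) (suc i) (s≤s l) = nth-default xs i l

  nth-ext : ∀ xs ys → length xs ≡ length ys →
    (∀ i → i < length xs → nth d xs i ≡ nth d ys i) → xs ≡ ys
  nth-ext []       []       _ _ = refl
  nth-ext (x ∷ xs) (y ∷ ys) e h =
    cong₂ _∷_ (h 0 z<s) (nth-ext xs ys (suc-injective e) (λ i l → h (suc i) (s≤s l)))

  nth-map-applyUpTo : ∀ (g : ℕ → A) f m i → i < m → nth d (map g (applyUpTo f m)) i ≡ g (f i)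
  nth-map-applyUpTo g f (suc m) zero    _ = refl
  nth-map-applyUpTo g f (suc m) (suc i) l = nth-map-applyUpTo g (f ∘ suc) m i (s≤s⁻¹ l)

  nth-∈ : ∀ xs i → i < length xs → nth d xs i ∈ xs
  nth-∈ (x ∷ xs) zero    _ = here refl
  nth-∈ (x ∷ xs) (suc i) l = there (nth-∈ xs i (s≤s⁻¹ l))

  ∈-nth : ∀ {x} xs → x ∈ xs → ∃ λ i → i < length xs × nth d xs i ≡ x
  ∈-nth (x ∷ xs) (here refl) = 0 , z<s , refl
  ∈-nth (x ∷ xs) (there x∈) with ∈-nth xs x∈
  ... | i , l , eq = suc i , s≤s l , eq

  AllPairs-nth : ∀ {R : A → A → Set} xs → AllPairs R xs →
    ∀ i j → i < j → j < length xs → R (nth d xs i) (nth d xs j)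
  AllPairs-nth (x ∷ xs) (rx ∷ rs) zero (suc j) _ l = All.lookup rx (nth-∈ xs j (s≤s⁻¹ l))
  AllPairs-nth (x ∷ xs) (rx ∷ rs) (suc i) (suc j) i<j l =
    AllPairs-nth xs rs i j (s≤s⁻¹ i<j) (s≤s⁻¹ l)

unique-set⇒↭ : ∀ {xs ys : List ℕ} → Unique xs → Unique ys →
  (∀ {x} → x ∈ xs → x ∈ ys) → (∀ {x} → x ∈ ys → x ∈ xs) → xs ↭ ys
unique-set⇒↭ ux uy f g = ∼bag⇒↭ (unique∧set⇒bag ux uy (mk⇔ f g))

-- Functions on an initial segment of ℕ receive the bound as a second argument.
injective⇒surjective : ∀ m (f : ∀ i → i < m → ℕ) → (∀ i l → f i l < m) →
  (∀ i j l l' → f i l ≡ f j l' → i ≡ j) →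
  ∀ j → j < m → ∃ λ i → ∃ λ (l : i < m) → f i l ≡ j
injective⇒surjective (suc m) f f<m inj j j<m with Fin.any? (λ i → f (toℕ i) (Fin.toℕ<n i) ≟ j)
... | yes (i , eq) = toℕ i , Fin.toℕ<n i , eq
... | no none = contradiction (λ {x} {y} → g-injective {x} {y}) (Fin.<⇒notInjective (n<1+n m))
  where
  F : Fin (suc m) → Fin (suc m)
  F i = fromℕ< (f<m (toℕ i) (Fin.toℕ<n i))
  missed : ∀ i → ¬ fromℕ< j<m ≡ F i
  missed i eq = none (i , trans (sym (Fin.toℕ-fromℕ< _))
    (trans (cong toℕ (sym eq)) (Fin.toℕ-fromℕ< _)))
  g : Fin (suc m) → Fin m
  g i = Fin.punchOut (missed i)
  g-injective : ∀ {x y} → g x ≡ g y → x ≡ y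
  g-injective {x} {y} eq = Fin.toℕ-injective (inj _ _ _ _ (trans (sym (Fin.toℕ-fromℕ< _))
    (trans (cong toℕ (Fin.punchOut-injective (missed x) (missed y) eq)) (Fin.toℕ-fromℕ< _))))

-- Strict increase from 0 gives `i ≤ f i`, and the `m ∸ suc i` strict steps left above `i` must
-- still fit below `m`, which gives `f i ≤ i`.
increasing⇒identity : ∀ m (f : ∀ i → i < m → ℕ) → (∀ i l → f i l < m) →
  (∀ i j l l' → i < j → f i l < f j l') → ∀ i l → f i l ≡ i
increasing⇒identity m f f<m mono i l =
  ≤-antisym (≤-trans (m+n≤o⇒m≤o∸n _ (above (m ∸ suc i) i l last)) (≤-reflexive cancel)) (below i l)
  where
    below : ∀ i l → i ≤ f i l
    below zero    l = z≤n
    below (suc i) l = ≤-<-trans (below i (<-trans (n<1+n i) l)) (mono _ _ _ _ (n<1+n i))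
    above : ∀ t i l → t + i < m → f i l + t ≤ m ∸ 1
    above zero i l _ = subst (_≤ m ∸ 1) (sym (+-identityʳ _)) (∸-monoˡ-≤ 1 (f<m i l))
    above (suc t) i l l' = begin
      f i l + suc t ≡⟨ +-suc _ t ⟩
      suc (f i l) + t ≤⟨ +-monoˡ-≤ t (mono i (suc i) l i+1<m (n<1+n i)) ⟩
      f (suc i) i+1<m + t ≤⟨ above t (suc i) i+1<m (subst (_< m) (sym (+-suc t i)) l') ⟩
      m ∸ 1 ∎
      where
        open ≤-Reasoning
        i+1<m : suc i < m
        i+1<m = ≤-<-trans (s≤s (m≤n+m i t)) l'
    last : m ∸ suc i + i < m
    last = ≤-reflexive (trans (sym (+-suc _ i)) (m∸n+n≡m l))
    cancel : m ∸ 1 ∸ (m ∸ suc i) ≡ i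
    cancel = trans (cong ((m ∸ 1) ∸_) (sym (∸-+-assoc m 1 i))) (m∸[m∸n]≡n (∸-monoˡ-≤ 1 l))

-- Paths through a filling of the n × n box

data Wire : Set where
  hwire vwire : ℕ → Wire

hwire-injective : ∀ {a b} → hwire a ≡ hwire b → a ≡ b
hwire-injective refl = refl

vwire-injective : ∀ {a b} → vwire a ≡ vwire b → a ≡ b
vwire-injective refl = refl

_≟ʷ_ : (w w' : Wire) → Dec (w ≡ w')
hwire a ≟ʷ hwire b = map′ (cong hwire) hwire-injective (a ≟ b)
hwire a ≟ʷ vwire b = no λ ()
vwire a ≟ʷ hwire b = no λ ()
vwire a ≟ʷ vwire b = map′ (cong vwire) vwire-injective (a ≟ b)

mirror : Wire → Wire
mirror (hwire a) = vwire a
mirror (vwire b) = hwire b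

mirror-involutive : ∀ w → mirror (mirror w) ≡ w
mirror-involutive (hwire a) = refl
mirror-involutive (vwire b) = refl

mirror-injective : ∀ {w w'} → mirror w ≡ mirror w' → w ≡ w'
mirror-injective {w} {w'} eq =
  trans (sym (mirror-involutive w)) (trans (cong mirror eq) (mirror-involutive w'))

-- The wire on which the path entering cell (a , b) from the west
-- (resp. north) started, when a cell with M a b ≡ true turns both paths.
hor ver : (ℕ → ℕ → Bool) → ℕ → ℕ → Wire
hor M a zero    = hwire a
hor M a (suc b) = if M a b then ver M a b else hor M a b
ver M zero    b = vwire b
ver M (suc a) b = if M a b then hor M a b else ver M a b

hor-turn : ∀ M a b → M a b ≡ true → hor M a (suc b) ≡ ver M a b
hor-turn M a b eq rewrite eq = refl

hor-pass : ∀ M a b → M a b ≡ false → hor M a (suc b) ≡ hor M a b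
hor-pass M a b eq rewrite eq = refl

ver-turn : ∀ M a b → M a b ≡ true → ver M (suc a) b ≡ hor M a b
ver-turn M a b eq rewrite eq = refl

ver-pass : ∀ M a b → M a b ≡ false → ver M (suc a) b ≡ ver M a b
ver-pass M a b eq rewrite eq = refl

transpose : (ℕ → ℕ → Bool) → ℕ → ℕ → Bool
transpose M a b = M b a

hor-mirror : ∀ M a b → hor (transpose M) a b ≡ mirror (ver M b a)
ver-mirror : ∀ M a b → ver (transpose M) a b ≡ mirror (hor M b a)
hor-mirror M a zero = refl
hor-mirror M a (suc b) with M b a
... | true  = ver-mirror M a b
... | false = hor-mirror M a b
ver-mirror M zero b = refl
ver-mirror M (suc a) b with M b a
... | true  = hor-mirror M a b
... | false = ver-mirror M a b

hor-const : ∀ M a b t → (∀ i → M a (b + i) ≡ false) → hor M a (b + t) ≡ hor M a b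
hor-const M a b zero    none = cong (hor M a) (+-identityʳ b)
hor-const M a b (suc t) none = trans (cong (hor M a) (+-suc b t))
  (trans (hor-pass M a (b + t) (none t)) (hor-const M a b t none))

ver-const : ∀ M a b t → (∀ i → M (a + i) b ≡ false) → ver M (a + t) b ≡ ver M a b
ver-const M a b t none = mirror-injective (trans (sym (hor-mirror M b (a + t)))
  (trans (hor-const (transpose M) b a t none) (hor-mirror M b a)))

hor-start : ∀ M a b → (∀ b' → b' < b → M a b' ≡ false) → hor M a b ≡ hwire a
hor-start M a zero    none = refl
hor-start M a (suc b) none = trans (hor-pass M a b (none b (n<1+n b)))
  (hor-start M a b (λ b' l → none b' (m<n⇒m<1+n l)))

ver-start : ∀ M a b → (∀ a' → a' < a → M a' b ≡ false) → ver M a b ≡ vwire b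
ver-start M a b none = mirror-injective (trans (sym (hor-mirror M b a))
    (hor-start (transpose M) b a none))

DownClosed : (ℕ → ℕ → Bool) → Set
DownClosed S = ∀ {a b a' b'} → a' ≤ a → b' ≤ b → S a b ≡ true → S a' b' ≡ true

_⊆_ : (M S : ℕ → ℕ → Bool) → Set
M ⊆ S = ∀ {a b} → M a b ≡ true → S a b ≡ true

-- Condition (2) of permutation tableaux: by hor-start and hor-unturned, the
-- two alternatives say that row a is zero left of b, column b zero above a.
LeFilling : (S M : ℕ → ℕ → Bool) → Set
LeFilling S M = ∀ a b → S a b ≡ true → M a b ≡ false → hor M a b ≡ hwire a ⊎ ver M a b ≡ vwire b

module Paths (S : ℕ → ℕ → Bool) (down : DownClosed S) where

  -- What is kept of the history of a path at a cell. On a wire of its own kind a path may never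
  -- have turned, so the inequality is weak; on the other kind it has turned, so the inequality is
  -- strict. Strictness says that the path of row `a` never enters a cell of row `a` from the north.
  -- The recorded cell of `S` is the crossing of the starting wire with the present one, which
  -- becomes `Reach` at the exit.
  FromWest FromNorth : ℕ → ℕ → Wire → Set
  FromWest a b (hwire i)  = i ≤ a
  FromWest a b (vwire j)  = j < b × S a j ≡ true
  FromNorth a b (hwire i) = i < a × S i b ≡ true
  FromNorth a b (vwire j) = j ≤ b

  hor-from : ∀ M → M ⊆ S → ∀ a b → FromWest a b (hor M a b)
  ver-from : ∀ M → M ⊆ S → ∀ a b → FromNorth a b (ver M a b)
  hor-from M M⊆S a zero = ≤-refl
  hor-from M M⊆S a (suc b) with M a b in eq
  ... | true  = turn (ver M a b) (ver-from M M⊆S a b)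
    where
    turn : ∀ w → FromNorth a b w → FromWest a (suc b) w
    turn (hwire i) (i<a , _) = <⇒≤ i<a
    turn (vwire j) j≤b       = s≤s j≤b , down ≤-refl j≤b (M⊆S eq)
  ... | false = pass (hor M a b) (hor-from M M⊆S a b)
    where
    pass : ∀ w → FromWest a b w → FromWest a (suc b) w
    pass (hwire i) i≤a       = i≤a
    pass (vwire j) (j<b , s) = m<n⇒m<1+n j<b , s
  ver-from M M⊆S zero b = ≤-refl
  ver-from M M⊆S (suc a) b with M a b in eq
  ... | true  = turn (hor M a b) (hor-from M M⊆S a b)
    where
    turn : ∀ w → FromWest a b w → FromNorth (suc a) b w
    turn (hwire i) i≤a       = s≤s i≤a , down i≤a ≤-refl (M⊆S eq)
    turn (vwire j) (j<b , _) = <⇒≤ j<b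
  ... | false = pass (ver M a b) (ver-from M M⊆S a b)
    where
    pass : ∀ w → FromNorth a b w → FromNorth (suc a) b w
    pass (hwire i) (i<a , s) = m<n⇒m<1+n i<a , s
    pass (vwire j) j≤b       = j≤b

  -- A turn at a cell of row `a` puts on the row a path coming from the north, and `FromNorth`
  -- forbids this to be the path of row `a` itself. So no turn is met when tracing back from `b`.
  hor-unturned : ∀ M → M ⊆ S → ∀ a b → hor M a b ≡ hwire a → ∀ b' → b' < b → M a b' ≡ false
  hor-unturned M M⊆S a (suc b) h b' b'<1+b with M a b in eq
  ... | true = contradiction (proj₁ (subst (FromNorth a b) h (ver-from M M⊆S a b))) (<-irrefl refl)
  ... | false with m≤n⇒m<n∨m≡n (s≤s⁻¹ b'<1+b)
  ...   | inj₁ b'<b = hor-unturned M M⊆S a b h b' b'<b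
  ...   | inj₂ refl = eq

  ver-unturned : ∀ M → M ⊆ S → ∀ a b → ver M a b ≡ vwire b → ∀ a' → a' < a → M a' b ≡ false
  ver-unturned M M⊆S (suc a) b v a' a'<1+a with M a b in eq
  ... | true = contradiction (proj₁ (subst (FromWest a b) v (hor-from M M⊆S a b))) (<-irrefl refl)
  ... | false with m≤n⇒m<n∨m≡n (s≤s⁻¹ a'<1+a)
  ...   | inj₁ a'<a = ver-unturned M M⊆S a b v a' a'<a
  ...   | inj₂ refl = eq

  -- Backward induction from the south and east sides of the box: agreement on the two edges leaving
  -- a cell forces the same bit in it, and undoing that bit gives agreement on the two edges
  -- entering it.
  LeFilling-unique : ∀ n M M' → M ⊆ S → M' ⊆ S → LeFilling S M → LeFilling S M' →
    (∀ a → a < n → hor M a n ≡ hor M' a n) → (∀ b → b < n → ver M n b ≡ ver M' n b) →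
    ∀ a b → a < n → b < n → M a b ≡ M' a b
  LeFilling-unique n M M' M⊆S M'⊆S le le' eh ev a b a<n b<n =
    cell≡ a b (hor≡ (n ∸ a) (n ∸ suc b) a (suc b) (m∸n+n≡m (<⇒≤ a<n)) (m∸n+n≡m b<n) a<n)
              (ver≡ (n ∸ suc a) (n ∸ b) (suc a) b (m∸n+n≡m a<n) (m∸n+n≡m (<⇒≤ b<n)) b<n)
    where
    -- A 0 in `M'` means that row `a` or column `b` leaves the cell with its own path, whereas the 1
    -- in `M` has just put there a path from the crossing wire, which cannot be that one.
    conflict : ∀ {M M'} → M ⊆ S → LeFilling S M' → ∀ a b →
      hor M a (suc b) ≡ hor M' a (suc b) → ver M (suc a) b ≡ ver M' (suc a) b →
      M a b ≡ true → ¬ M' a b ≡ false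
    conflict {M} {M'} M⊆S le' a b h v t f with le' a b (M⊆S t) f
    ... | inj₁ h' = <-irrefl refl (proj₁ (subst (FromNorth a b)
          (trans (trans (sym (hor-turn M a b t)) h) (trans (hor-pass M' a b f) h'))
              (ver-from M M⊆S a b)))
    ... | inj₂ v' = <-irrefl refl (proj₁ (subst (FromWest a b)
          (trans (trans (sym (ver-turn M a b t)) v) (trans (ver-pass M' a b f) v'))
              (hor-from M M⊆S a b)))

    cell≡ : ∀ a b → hor M a (suc b) ≡ hor M' a (suc b) → ver M (suc a) b ≡ ver M' (suc a) b →
      M a b ≡ M' a b
    cell≡ a b h v = bool-ext (λ t → ¬-not (conflict M⊆S le' a b h v t))
                             (λ t → ¬-not (conflict M'⊆S le a b (sym h) (sym v) t))

    before≡ : ∀ a b → hor M a (suc b) ≡ hor M' a (suc b) → ver M (suc a) b ≡ ver M' (suc a) b →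
      hor M a b ≡ hor M' a b × ver M a b ≡ ver M' a b
    before≡ a b h v with M a b in eq | M' a b in eq' | cell≡ a b h v
    ... | true  | true  | _ = trans (sym (ver-turn M a b eq)) (trans v (ver-turn M' a b eq'))
                            , trans (sym (hor-turn M a b eq)) (trans h (hor-turn M' a b eq'))
    ... | false | false | _ = trans (sym (hor-pass M a b eq)) (trans h (hor-pass M' a b eq'))
                            , trans (sym (ver-pass M a b eq)) (trans v (ver-pass M' a b eq'))

    hor≡ : ∀ s t a b → s + a ≡ n → t + b ≡ n → a < n → hor M a b ≡ hor M' a b
    ver≡ : ∀ s t a b → s + a ≡ n → t + b ≡ n → b < n → ver M a b ≡ ver M' a b
    hor≡ zero    t       a b refl eb   a<n = contradiction a<n (<-irrefl refl)
    hor≡ (suc s) zero    a b ea   refl a<n = eh a a<n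
    hor≡ (suc s) (suc t) a b ea   eb   a<n = proj₁ (before≡ a b
      (hor≡ (suc s) t a (suc b) ea (trans (+-suc t b) eb) a<n)
      (ver≡ s (suc t) (suc a) b (trans (+-suc s a) ea) eb (subst (b <_) eb (s≤s (m≤n+m b t)))))
    ver≡ s       zero    a b ea   refl b<n = contradiction b<n (<-irrefl refl)
    ver≡ zero    (suc t) a b refl eb   b<n = ev b b<n
    ver≡ (suc s) (suc t) a b ea   eb   b<n = proj₂ (before≡ a b
      (hor≡ (suc s) t a (suc b) ea (trans (+-suc t b) eb) (subst (a <_) ea (s≤s (m≤n+m a s))))
      (ver≡ s (suc t) (suc a) b (trans (+-suc s a) ea) eb b<n))

-- Reconstruction of a filling from the exits of its paths

InBox : ℕ → Wire → Set
InBox n (hwire a) = a < n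
InBox n (vwire b) = b < n

-- Reach S e w: a path starting on wire w may end on wire e.
Reach : (ℕ → ℕ → Bool) → Wire → Wire → Set
Reach S (hwire i) (hwire i') = i' ≤ i
Reach S (hwire i) (vwire j)  = S i j ≡ true
Reach S (vwire j) (hwire i)  = S i j ≡ true
Reach S (vwire j) (vwire j') = j' ≤ j

swap : ℕ → ℕ → Wire → Wire
swap a b (hwire i) with i ≟ a
... | yes _ = vwire b
... | no _  = hwire i
swap a b (vwire j) with j ≟ b
... | yes _ = hwire a
... | no _  = vwire j

data SwapView (a b : ℕ) : Wire → Wire → Set where
  at-row   : SwapView a b (hwire a) (vwire b)
  at-col   : SwapView a b (vwire b) (hwire a)
  off-row  : ∀ {i} → i ≢ a → SwapView a b (hwire i) (hwire i)
  off-col  : ∀ {j} → j ≢ b → SwapView a b (vwire j) (vwire j)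

swap-view : ∀ a b w → SwapView a b w (swap a b w)
swap-view a b (hwire i) with i ≟ a
... | yes refl = at-row
... | no i≢a   = off-row i≢a
swap-view a b (vwire j) with j ≟ b
... | yes refl = at-col
... | no j≢b   = off-col j≢b

swap-injective : ∀ a b {w w'} → swap a b w ≡ swap a b w' → w ≡ w'
swap-injective a b {w} {w'} eq = go (swap-view a b w) (swap-view a b w') eq
  where
  go : ∀ {w w' u u'} → SwapView a b w u → SwapView a b w' u' → u ≡ u' → w ≡ w'
  go at-row      at-row      _    = refl
  go at-row      (off-col n) refl = contradiction refl n
  go at-col      at-col      _    = refl
  go at-col      (off-row n) refl = contradiction refl n
  go (off-row n) at-col      refl = contradiction refl n
  go (off-row _) (off-row _) refl = refl
  go (off-col n) at-row      refl = contradiction refl n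
  go (off-col _) (off-col _) refl = refl

swap-inBox : ∀ {n a b w u} → a < n → b < n → SwapView a b w u → InBox n w → InBox n u
swap-inBox a<n b<n at-row      _ = b<n
swap-inBox a<n b<n at-col      _ = a<n
swap-inBox a<n b<n (off-row _) l = l
swap-inBox a<n b<n (off-col _) l = l

swap-row : ∀ a b → swap a b (hwire a) ≡ vwire b
swap-row a b with swap a b (hwire a) | swap-view a b (hwire a)
... | _ | at-row    = refl
... | _ | off-row n = contradiction refl n

swap-col : ∀ a b → swap a b (vwire b) ≡ hwire a
swap-col a b with swap a b (vwire b) | swap-view a b (vwire b)
... | _ | at-col    = refl
... | _ | off-col n = contradiction refl n

swap-off-row : ∀ a b {i} → i ≢ a → swap a b (hwire i) ≡ hwire i
swap-off-row a b {i} i≢a with swap a b (hwire i) | swap-view a b (hwire i)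
... | _ | at-row    = contradiction refl i≢a
... | _ | off-row _ = refl

swap-off-col : ∀ a b {j} → j ≢ b → swap a b (vwire j) ≡ vwire j
swap-off-col a b {j} j≢b with swap a b (vwire j) | swap-view a b (vwire j)
... | _ | at-col    = contradiction refl j≢b
... | _ | off-col _ = refl

swapIf : Bool → ℕ → ℕ → Wire → Wire
swapIf true  = swap
swapIf false = λ _ _ w → w

swapIf-off-row : ∀ m a b {i} → i ≢ a → swapIf m a b (hwire i) ≡ hwire i
swapIf-off-row true  a b = swap-off-row a b
swapIf-off-row false a b _ = refl

swapIf-off-col : ∀ m a b {j} → j ≢ b → swapIf m a b (vwire j) ≡ vwire j
swapIf-off-col true  a b = swap-off-col a b
swapIf-off-col false a b _ = refl

InjectiveOn : ℕ → (Wire → Wire) → Set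
InjectiveOn n ρ = ∀ w w' → InBox n w → InBox n w' → ρ w ≡ ρ w' → w ≡ w'

-- A state assigns to every wire the starting wire of the path currently on it.
-- Cells are undone in reverse row-major order.  In a Le-filling, a cell is 0
-- exactly when, after it, the path on its row or its column is still the one
-- that started there.
module Reconstruct (n : ℕ) (S : ℕ → ℕ → Bool) (down : DownClosed S)
  (bounded : ∀ {a b} → S a b ≡ true → a < n × b < n)
  (σ : Wire → Wire) (σ-inj : InjectiveOn n σ)
  (σ-reach : ∀ w → InBox n w → Reach S w (σ w)) where

  turns : ℕ → ℕ → (Wire → Wire) → Bool
  turns a b ρ with S a b | ρ (hwire a) ≟ʷ hwire a | ρ (vwire b) ≟ʷ vwire b
  ... | true | no _ | no _ = true
  ... | _    | _    | _    = false

  data TurnView (a b : ℕ) (ρ : Wire → Wire) : Bool → Set where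
    turned : S a b ≡ true → ρ (hwire a) ≢ hwire a → ρ (vwire b) ≢ vwire b → TurnView a b ρ true
    passed : (S a b ≡ true → ρ (hwire a) ≡ hwire a ⊎ ρ (vwire b) ≡ vwire b) → TurnView a b ρ false

  turn-view : ∀ a b ρ → TurnView a b ρ (turns a b ρ)
  turn-view a b ρ with S a b in s | ρ (hwire a) ≟ʷ hwire a | ρ (vwire b) ≟ʷ vwire b
  ... | false | _     | _     = passed (λ t → contradiction s (true≢false t))
  ... | true  | yes p | _     = passed (λ _ → inj₁ p)
  ... | true  | no _  | yes q = passed (λ _ → inj₂ q)
  ... | true  | no p  | no q  = turned s p q

  undo : ℕ → ℕ → (Wire → Wire) → Wire → Wire
  undo a b ρ w = ρ (swapIf (turns a b ρ) a b w)

  Before : ℕ → ℕ → ℕ → ℕ → Set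
  Before a b i j = i < a ⊎ (i ≡ a × j < b)

  before-suc : ∀ {a b i j} → Before a (suc b) i j → Before a b i j ⊎ (i ≡ a × j ≡ b)
  before-suc (inj₁ l) = inj₁ (inj₁ l)
  before-suc (inj₂ (refl , l)) with m≤n⇒m<n∨m≡n (s≤s⁻¹ l)
  ... | inj₁ j<b  = inj₁ (inj₂ (refl , j<b))
  ... | inj₂ refl = inj₂ (refl , refl)

  -- The invariant behind the undoing: a path may sit on a wire of the other kind only if the
  -- crossing of that wire with its starting wire is a cell not yet undone. With nothing undone this
  -- is `Reach`; at `(0 , 0)` no such cell is left, and every path is on a wire of its own kind.
  ReachBefore : ℕ → ℕ → Wire → Wire → Set
  ReachBefore a b (hwire i) (hwire i') = i' ≤ i
  ReachBefore a b (hwire i) (vwire j)  = S i j ≡ true × Before a b i j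
  ReachBefore a b (vwire j) (hwire i)  = S i j ≡ true × Before a b i j
  ReachBefore a b (vwire j) (vwire j') = j' ≤ j

  Inv : ℕ → ℕ → (Wire → Wire) → Set
  Inv a b ρ = InjectiveOn n ρ × (∀ w → InBox n w → ReachBefore a b w (ρ w))

  -- The cell `(a , b)` is the only one to drop out of `Before`. If it is a cell of `S` left
  -- unturned, row `a` or column `b` carries its own path, so by injectivity neither of these two
  -- paths is on the wire of the other. If it is turned, neither wire carries its own path, so the
  -- index inequality is strict and the new crossing lies before `(a , b)`.
  undo-inv : ∀ a b ρ → a < n → b < n → Inv a (suc b) ρ → Inv a b (undo a b ρ)
  undo-inv a b ρ a<n b<n (inj , reach) with turns a b ρ | turn-view a b ρ
  ... | false | passed fixed = inj , λ w l → shrink w (ρ w) refl (reach w l)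
    where
    shrink : ∀ w u → ρ w ≡ u → ReachBefore a (suc b) w u → ReachBefore a b w u
    shrink (hwire i) (hwire i') _ r = r
    shrink (vwire j) (vwire j') _ r = r
    shrink (hwire i) (vwire j) e (s , r) with before-suc r
    ... | inj₁ r' = s , r'
    ... | inj₂ (refl , refl) with fixed s
    ...   | inj₁ p = contradiction (trans (sym p) e) λ ()
    ...   | inj₂ p = contradiction (inj (hwire i) (vwire j) a<n b<n (trans e (sym p))) λ ()
    shrink (vwire j) (hwire i) e (s , r) with before-suc r
    ... | inj₁ r' = s , r'
    ... | inj₂ (refl , refl) with fixed s
    ...   | inj₂ p = contradiction (trans (sym p) e) λ ()
    ...   | inj₁ p = contradiction (inj (vwire j) (hwire i) b<n a<n (trans e (sym p))) λ ()
  ... | true | turned s nrow ncol =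
    (λ w w' l l' e → swap-injective a b (inj _ _ (swap-inBox a<n b<n (swap-view a b w) l)
                                                 (swap-inBox a<n b<n (swap-view a b w') l') e))
    , λ w l → move w (swap a b w) (ρ (swap a b w)) refl (swap-view a b w)
                (reach _ (swap-inBox a<n b<n (swap-view a b w) l))
    where
    before-a : ∀ {i j} → Before a (suc b) i j → i ≤ a
    before-a (inj₁ l)          = <⇒≤ l
    before-a (inj₂ (refl , _)) = ≤-refl
    before-b : ∀ {j} → Before a (suc b) a j → j ≤ b
    before-b (inj₁ l)       = contradiction l (<-irrefl refl)
    before-b (inj₂ (_ , l)) = s≤s⁻¹ l
    move : ∀ w v u → ρ v ≡ u → SwapView a b w v → ReachBefore a (suc b) v u → ReachBefore a b w u
    move _ _ (hwire i) e at-row (_ , r) = before-a r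
    move _ _ (vwire j) e at-row j≤b =
      down ≤-refl j≤b s , inj₂ (refl , ≤∧≢⇒< j≤b (λ { refl → ncol e }))
    move _ _ (hwire i) e at-col i≤a =
      down i≤a ≤-refl s , inj₁ (≤∧≢⇒< i≤a (λ { refl → nrow e }))
    move _ _ (vwire j) e at-col (_ , r) = before-b r
    move _ _ (hwire i) e (off-row _) r = r
    move _ _ (vwire j) e (off-row i≢a) (s , r) with before-suc r
    ... | inj₁ r'         = s , r'
    ... | inj₂ (refl , _) = contradiction refl i≢a
    move _ _ (vwire j) e (off-col _) r = r
    move _ _ (hwire i) e (off-col j≢b) (s , r) with before-suc r
    ... | inj₁ r'         = s , r'
    ... | inj₂ (_ , refl) = contradiction refl j≢b

  -- In stateFromEnd (suc i) j the lowest i rows are undone, and the row above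
  -- them (index n ∸ suc i) from the right down to column n ∸ j.
  stateFromEnd : ℕ → ℕ → Wire → Wire
  stateFromEnd zero    j       = σ
  stateFromEnd (suc i) zero    = stateFromEnd i n
  stateFromEnd (suc i) (suc j) = undo (n ∸ suc i) (n ∸ suc j) (stateFromEnd (suc i) j)

  inv-next-row : ∀ a ρ → Inv (suc a) 0 ρ → Inv a n ρ
  inv-next-row a ρ (inj , reach) = inj , λ w l → go w (ρ w) (reach w l)
    where
    before : ∀ {i j} → S i j ≡ true → Before (suc a) 0 i j → Before a n i j
    before s (inj₁ l) with m≤n⇒m<n∨m≡n (s≤s⁻¹ l)
    ... | inj₁ i<a  = inj₁ i<a
    ... | inj₂ refl = inj₂ (refl , proj₂ (bounded s))
    go : ∀ w u → ReachBefore (suc a) 0 w u → ReachBefore a n w u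
    go (hwire i) (hwire i') r = r
    go (vwire j) (vwire j') r = r
    go (hwire i) (vwire j) (s , r) = s , before s r
    go (vwire j) (hwire i) (s , r) = s , before s r

  n∸-suc : ∀ {i} → i < n → n ∸ i ≡ suc (n ∸ suc i)
  n∸-suc {i} i<n = +-∸-assoc 1 i<n

  stateFromEnd-inv : ∀ i j → i ≤ n → j ≤ n → Inv (n ∸ i) (n ∸ j) (stateFromEnd i j)
  stateFromEnd-inv zero j _ _ = σ-inj , λ w l → go w (σ w) (σ-reach w l)
    where
    go : ∀ w u → Reach S w u → ReachBefore n (n ∸ j) w u
    go (hwire i) (hwire i') r = r
    go (vwire j) (vwire j') r = r
    go (hwire i) (vwire j) s = s , inj₁ (proj₁ (bounded s))
    go (vwire j) (hwire i) s = s , inj₁ (proj₁ (bounded s))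
  stateFromEnd-inv (suc i) zero i<n _ = inv-next-row (n ∸ suc i) _
    (subst₂ (λ a b → Inv a b (stateFromEnd i n)) (n∸-suc i<n) (n∸n≡0 n)
        (stateFromEnd-inv i n (<⇒≤ i<n) ≤-refl))
  stateFromEnd-inv (suc i) (suc j) i<n j<n = undo-inv (n ∸ suc i) (n ∸ suc j) _
    (∸-monoʳ-< z<s i<n) (∸-monoʳ-< z<s j<n)
    (subst (λ b → Inv (n ∸ suc i) b (stateFromEnd (suc i) j)) (n∸-suc j<n)
        (stateFromEnd-inv (suc i) j i<n (<⇒≤ j<n)))

  state : ℕ → ℕ → Wire → Wire
  state a b = stateFromEnd (n ∸ a) (n ∸ b)

  filling : ℕ → ℕ → Bool
  filling a b = turns a b (state a (suc b))

  state-inv : ∀ a b → a ≤ n → b ≤ n → Inv a b (state a b)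
  state-inv a b a≤n b≤n = subst₂ (λ x y → Inv x y (state a b)) (m∸[m∸n]≡n a≤n) (m∸[m∸n]≡n b≤n)
    (stateFromEnd-inv (n ∸ a) (n ∸ b) (m∸n≤m n a) (m∸n≤m n b))

  state-undo : ∀ a b w → a < n → b < n → state a b w ≡ state a (suc b) (swapIf (filling a b) a b w)
  state-undo a b w a<n b<n = begin
    state a b w
      ≡⟨ cong₂ (λ x y → stateFromEnd x y w) (n∸-suc a<n) (n∸-suc b<n) ⟩
    undo (n ∸ suc (n ∸ suc a)) (n ∸ suc (n ∸ suc b)) (stateFromEnd (suc (n ∸ suc a)) (n ∸ suc b)) w
      ≡⟨ cong₂ (λ x y → undo (n ∸ x) (n ∸ y) (stateFromEnd x (n ∸ suc b)) w) (n∸-suc a<n) (n∸-suc b<n) ⟨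
    undo (n ∸ (n ∸ a)) (n ∸ (n ∸ b)) (state a (suc b)) w
      ≡⟨ cong₂ (λ x y → undo x y (state a (suc b)) w) (m∸[m∸n]≡n (<⇒≤ a<n)) (m∸[m∸n]≡n (<⇒≤ b<n)) ⟩
    undo a b (state a (suc b)) w ∎
    where open ≡-Reasoning

  state-row-end : ∀ a → a < n → state a n ≡ state (suc a) 0
  state-row-end a a<n rewrite n∸n≡0 n | n∸-suc a<n = refl

  state-end : ∀ b → state n b ≡ σ
  state-end b rewrite n∸n≡0 n = refl

  -- A state belongs to one moment of the row-major order, while `hor` and `ver` at `(a , b)`
  -- concern a single wire. This and the following lemmas skip the cells that do not touch the wire:
  -- row `i` is changed only by cells of row `i`, column `j` only by cells of column `j`.
  state-row-const : ∀ {i} a b → i ≢ a → a < n → b ≤ n → state a 0 (hwire i) ≡ state a b (hwire i)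
  state-row-const a zero    i≢a a<n b≤n = refl
  state-row-const a (suc b) i≢a a<n b<n =
    trans (state-row-const a b i≢a a<n (<⇒≤ b<n))
      (trans (state-undo a b _ a<n b<n)
        (cong (state a (suc b)) (swapIf-off-row (filling a b) a b i≢a)))

  state-col-const : ∀ {j} a b t → a < n → b + t ≤ n → (∀ i → b ≤ i → i < b + t → j ≢ i) →
    state a b (vwire j) ≡ state a (b + t) (vwire j)
  state-col-const {j} a b zero a<n l off = cong (λ x → state a x (vwire j)) (sym (+-identityʳ b))
  state-col-const {j} a b (suc t) a<n l off rewrite +-suc b t =
    trans (state-col-const a b t a<n (<⇒≤ l) (λ i p q → off i p (m<n⇒m<1+n q)))
      (trans (state-undo a (b + t) _ a<n l)
        (cong (state a (suc (b + t)))
          (swapIf-off-col (filling a (b + t)) a (b + t) (off (b + t) (m≤m+n b t) (n<1+n _)))))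

  state-next-row : ∀ {i} a → i ≢ a → a < n → state a 0 (hwire i) ≡ state (suc a) 0 (hwire i)
  state-next-row {i} a i≢a a<n =
    trans (state-row-const a n i≢a a<n ≤-refl) (cong (λ ρ → ρ (hwire i)) (state-row-end a a<n))

  state-row-above : ∀ i a → i < n → a ≤ i → state 0 0 (hwire i) ≡ state a 0 (hwire i)
  state-row-above i zero    i<n _   = refl
  state-row-above i (suc a) i<n a<i =
    trans (state-row-above i a i<n (<⇒≤ a<i))
      (state-next-row a (λ { refl → <-irrefl refl a<i }) (<-trans a<i i<n))

  state-row-below : ∀ i t a → t + a ≡ n → i < a → state a 0 (hwire i) ≡ σ (hwire i)
  state-row-below i zero    a refl i<a = cong (λ ρ → ρ (hwire i)) (state-end 0)
  state-row-below i (suc t) a e    i<a =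
    trans (state-next-row a (λ { refl → <-irrefl refl i<a }) (subst (a <_) e (s≤s (m≤n+m a t))))
      (state-row-below i t (suc a) (trans (+-suc t a) e) (m<n⇒m<1+n i<a))

  state-col-left : ∀ a b → a ≤ n → b < n → state a 0 (vwire b) ≡ state a b (vwire b)
  state-col-left a b a≤n b<n with m≤n⇒m<n∨m≡n a≤n
  ... | inj₁ a<n  = state-col-const a 0 b a<n (<⇒≤ b<n) (λ { i _ i<b refl → <-irrefl refl i<b })
  ... | inj₂ refl = cong (λ ρ → ρ (vwire b)) (trans (state-end 0) (sym (state-end b)))

  -- Between the moments just after `(a , b)` and just before `(suc a , b)` the row-major order
  -- visits the rest of row `a` and the beginning of the next row, all off column `b`.
  state-col-right : ∀ a b → a < n → b < n → state a (suc b) (vwire b) ≡ state (suc a) b (vwire b)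
  state-col-right a b a<n b<n = begin
    state a (suc b) (vwire b)
      ≡⟨ state-col-const a (suc b) (n ∸ suc b) a<n (≤-reflexive (m+[n∸m]≡n b<n))
           (λ { i b<i _ refl → <-irrefl refl b<i }) ⟩
    state a (suc b + (n ∸ suc b)) (vwire b)
      ≡⟨ cong (λ x → state a x (vwire b)) (m+[n∸m]≡n b<n) ⟩
    state a n (vwire b)
      ≡⟨ cong (λ ρ → ρ (vwire b)) (state-row-end a a<n) ⟩
    state (suc a) 0 (vwire b)
      ≡⟨ state-col-left (suc a) b a<n b<n ⟩
    state (suc a) b (vwire b) ∎
    where open ≡-Reasoning

  -- At `(0 , 0)` the invariant leaves each wire with a path of its own kind and of no larger index.
  -- If the index were smaller, say `i'`, the induction hypothesis would put that path on wire `i'`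
  -- as well, against injectivity.
  state-start : ∀ w → InBox n w → state 0 0 w ≡ w
  state-start (hwire i) = <-rec (λ i → i < n → state 0 0 (hwire i) ≡ hwire i) step i
    where
    step : ∀ i → (∀ {i'} → i' < i → i' < n → state 0 0 (hwire i') ≡ hwire i') → i < n →
      state 0 0 (hwire i) ≡ hwire i
    step i ih i<n with state 0 0 (hwire i) in e | proj₂ (state-inv 0 0 z≤n z≤n) (hwire i) i<n
    ... | vwire j  | _ , inj₁ ()
    ... | vwire j  | _ , inj₂ (_ , ())
    ... | hwire i' | i'≤i with m≤n⇒m<n∨m≡n i'≤i
    ...   | inj₂ refl = refl
    ...   | inj₁ i'<i = sym (proj₁ (state-inv 0 0 z≤n z≤n) _ _ i<n (<-trans i'<i i<n)
                               (trans e (sym (ih i'<i (<-trans i'<i i<n)))))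
  state-start (vwire j) = <-rec (λ j → j < n → state 0 0 (vwire j) ≡ vwire j) step j
    where
    step : ∀ j → (∀ {j'} → j' < j → j' < n → state 0 0 (vwire j') ≡ vwire j') → j < n →
      state 0 0 (vwire j) ≡ vwire j
    step j ih j<n with state 0 0 (vwire j) in e | proj₂ (state-inv 0 0 z≤n z≤n) (vwire j) j<n
    ... | hwire i  | _ , inj₁ ()
    ... | hwire i  | _ , inj₂ (_ , ())
    ... | vwire j' | j'≤j with m≤n⇒m<n∨m≡n j'≤j
    ...   | inj₂ refl = refl
    ...   | inj₁ j'<j = sym (proj₁ (state-inv 0 0 z≤n z≤n) _ _ j<n (<-trans j'<j j<n)
                               (trans e (sym (ih j'<j (<-trans j'<j j<n)))))

  -- The undone swaps are replayed forwards: both sides start at the identity by `state-start` and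
  -- obey the same recursion. So the bits found backwards do send the paths to the exits prescribed
  -- by `σ`.
  hor-state : ∀ a b → a < n → b ≤ n → hor filling a b ≡ state a b (hwire a)
  ver-state : ∀ a b → a ≤ n → b < n → ver filling a b ≡ state a b (vwire b)
  hor-state a zero a<n _ = sym (trans (sym (state-row-above a a a<n ≤-refl)) (state-start (hwire a) a<n))
  hor-state a (suc b) a<n b<n with filling a b | state-undo a b (hwire a) a<n b<n | state-undo a b
      (vwire b) a<n b<n
  ... | true  | _ | e = trans (ver-state a b (<⇒≤ a<n) b<n)
      (trans e (cong (state a (suc b)) (swap-col a b)))
  ... | false | e | _ = trans (hor-state a b a<n (<⇒≤ b<n)) e
  ver-state zero b _ b<n = sym (trans (sym (state-col-left 0 b z≤n b<n)) (state-start (vwire b) b<n))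
  ver-state (suc a) b a<n b<n with filling a b | state-undo a b (hwire a) a<n b<n | state-undo a b
      (vwire b) a<n b<n
  ... | true  | e | _ = trans (hor-state a b a<n (<⇒≤ b<n))
      (trans e (trans (cong (state a (suc b)) (swap-row a b)) (state-col-right a b a<n b<n)))
  ... | false | _ | e = trans (ver-state a b (<⇒≤ a<n) b<n) (trans e (state-col-right a b a<n b<n))

  filling-hor : ∀ a → a < n → hor filling a n ≡ σ (hwire a)
  filling-hor a a<n = trans (hor-state a n a<n ≤-refl)
    (trans (cong (λ ρ → ρ (hwire a)) (state-row-end a a<n))
      (state-row-below a (n ∸ suc a) (suc a) (m∸n+n≡m a<n) (n<1+n a)))

  filling-ver : ∀ b → b < n → ver filling n b ≡ σ (vwire b)
  filling-ver b b<n = trans (ver-state n b ≤-refl b<n) (cong (λ ρ → ρ (vwire b)) (state-end b))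

  filling-⊆ : filling ⊆ S
  filling-⊆ {a} {b} t with filling a b | turn-view a b (state a (suc b))
  filling-⊆ t | true | turned s _ _ = s

  filling-le : LeFilling S filling
  filling-le a b s f with bounded s
  ... | a<n , b<n with filling a b | turn-view a b (state a (suc b))
                     | state-undo a b (hwire a) a<n b<n | state-undo a b (vwire b) a<n b<n
  ...   | false | passed fixed | eh | ev with fixed s
  ...     | inj₁ p = inj₁ (trans (hor-state a b a<n (<⇒≤ b<n)) (trans eh p))
  ...     | inj₂ p = inj₂ (trans (ver-state a b (<⇒≤ a<n) b<n) (trans ev p))

-- `find` sends an index of `ρ` to the index of the same value in `ρ'`; as an increasing map of the
-- numbers below `n` to themselves it is the identity.
increasing-enumeration-unique : ∀ n (ρ ρ' : ℕ → ℕ) →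
  (∀ a b → a < b → b < n → ρ a < ρ b) → (∀ a b → a < b → b < n → ρ' a < ρ' b) →
  (∀ a → a < n → ∃ λ a' → a' < n × ρ' a' ≡ ρ a) → ∀ a → a < n → ρ a ≡ ρ' a
increasing-enumeration-unique n ρ ρ' mono mono' find a a<n =
  trans (sym (proj₂ (proj₂ (find a a<n))))
        (cong ρ' (increasing⇒identity n (λ a l → proj₁ (find a l))
            (λ a l → proj₁ (proj₂ (find a l))) find-mono a a<n))
  where
  find-mono : ∀ i j l l' → i < j → proj₁ (find i l) < proj₁ (find j l')
  find-mono i j l l' i<j with find i l | find j l'
  ... | x , x<n , ex | y , y<n , ey = ≰⇒> λ y≤x → <⇒≱ (mono i j i<j l')
    (subst₂ _≤_ ey ex (reflect y≤x))
    where
    reflect : y ≤ x → ρ' y ≤ ρ' x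
    reflect y≤x with m≤n⇒m<n∨m≡n y≤x
    ... | inj₁ y<x  = <⇒≤ (mono' y x y<x x<n)
    ... | inj₂ refl = ≤-refl

-- Labels of the boundary steps

n+n≡2*n : ∀ n → n + n ≡ 2 * n
n+n≡2*n n = cong (n +_) (sym (+-identityʳ n))

-- The order in which the boundary steps of the shape S are met from north-east
-- to south-west.
Precedes : (ℕ → ℕ → Bool) → Wire → Wire → Set
Precedes S (hwire a) (hwire a') = a < a'
Precedes S (hwire a) (vwire c)  = S a c ≡ true
Precedes S (vwire c) (hwire a)  = S a c ≡ false
Precedes S (vwire c) (vwire c') = c' < c

-- Only the order of the boundary steps and the range of the labels are recorded, since they already
-- determine the labels. The formulas of `rowLabel` and `colLabel` can then be identified with
-- labels prescribed by a permutation without computing row lengths.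
record IsLabelling (n : ℕ) (S : ℕ → ℕ → Bool) (L : Wire → ℕ) : Set where
  field
    mono     : ∀ {w w'} → InBox n w → InBox n w' → Precedes S w w' → L w < L w'
    positive : ∀ {w} → InBox n w → 0 < L w
    bounded  : ∀ {w} → InBox n w → L w ≤ 2 * n

precedes-total : ∀ S w w' → w ≡ w' ⊎ Precedes S w w' ⊎ Precedes S w' w
precedes-total S (hwire a) (hwire b) with <-cmp a b
... | tri< l _ _    = inj₂ (inj₁ l)
... | tri≈ _ refl _ = inj₁ refl
... | tri> _ _ l    = inj₂ (inj₂ l)
precedes-total S (vwire a) (vwire b) with <-cmp a b
... | tri< l _ _    = inj₂ (inj₂ l)
... | tri≈ _ refl _ = inj₁ refl
... | tri> _ _ l    = inj₂ (inj₁ l)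
precedes-total S (hwire a) (vwire c) with S a c
... | true  = inj₂ (inj₁ refl)
... | false = inj₂ (inj₂ refl)
precedes-total S (vwire c) (hwire a) with S a c
... | true  = inj₂ (inj₂ refl)
... | false = inj₂ (inj₁ refl)

-- An arbitrary numbering of the wires, unrelated to the labels, that makes their number `2 * n`
-- available to the pigeonhole principle.
fromIndex : ℕ → ℕ → Wire
fromIndex n i with i <? n
... | yes _ = hwire i
... | no _  = vwire (i ∸ n)

fromIndex-inBox : ∀ n i → i < 2 * n → InBox n (fromIndex n i)
fromIndex-inBox n i l with i <? n
... | yes i<n = i<n
... | no i≮n  = +-cancelʳ-< n (i ∸ n) n
  (subst₂ _<_ (sym (m∸n+n≡m (≮⇒≥ i≮n))) (sym (n+n≡2*n n)) l)

fromIndex-injective : ∀ n i j → fromIndex n i ≡ fromIndex n j → i ≡ j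
fromIndex-injective n i j eq with i <? n | j <? n
... | yes _  | yes _  = hwire-injective eq
... | no i≮n | no j≮n = trans (sym (m∸n+n≡m (≮⇒≥ i≮n)))
  (trans (cong (_+ n) (vwire-injective eq)) (m∸n+n≡m (≮⇒≥ j≮n)))

module Labelling {n S L} (lab : IsLabelling n S L) where
  open IsLabelling lab public

  suc-pred-label : ∀ {w} → InBox n w → suc (pred (L w)) ≡ L w
  suc-pred-label {w} i with L w | positive i
  ... | suc _ | _ = refl

  injective : ∀ {w w'} → InBox n w → InBox n w' → L w ≡ L w' → w ≡ w'
  injective {w} {w'} i i' eq with precedes-total S w w'
  ... | inj₁ e        = e
  ... | inj₂ (inj₁ p) = contradiction (mono i i' p) (<-irrefl eq)
  ... | inj₂ (inj₂ p) = contradiction (mono i' i p) (<-irrefl (sym eq))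

  reflects : ∀ {w w'} → InBox n w → InBox n w' → L w < L w' → Precedes S w w'
  reflects {w} {w'} i i' l with precedes-total S w w'
  ... | inj₁ refl     = contradiction l (<-irrefl refl)
  ... | inj₂ (inj₁ p) = p
  ... | inj₂ (inj₂ p) = contradiction (mono i' i p) (<-asym l)

  abstract
    surjective : ∀ i → i < 2 * n → ∃ λ w → InBox n w × L w ≡ suc i
    surjective i l with injective⇒surjective (2 * n) (λ i _ → pred (L (fromIndex n i)))
        (λ i l → subst (_≤ 2 * n) (sym (suc-pred-label (fromIndex-inBox n i l)))
            (bounded (fromIndex-inBox n i l)))
        (λ i j l l' e → fromIndex-injective n i j (injective (fromIndex-inBox n i l)
            (fromIndex-inBox n j l')
          (trans (sym (suc-pred-label (fromIndex-inBox n i l)))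
            (trans (cong suc e) (suc-pred-label (fromIndex-inBox n j l'))))))
        i l
    ... | j , l' , e = fromIndex n j , fromIndex-inBox n j l'
                     , trans (sym (suc-pred-label (fromIndex-inBox n j l'))) (cong suc e)

-- `relabel` sends an `L`-label to the `L'`-label of the same wire, both shifted to start at 0.
-- Labellings preserve and reflect the order of the steps, so it is an increasing self-map of a
-- finite segment.
labelling-unique : ∀ {n S L L'} → IsLabelling n S L → IsLabelling n S L' →
  ∀ {w} → InBox n w → L w ≡ L' w
labelling-unique {n} {S} {L} {L'} lab lab' {w} w∈ =
  trans (sym (A.suc-pred-label w∈)) (trans (cong suc (sym pred≡)) (B.suc-pred-label w∈))
  where
  module A = Labelling lab
  module B = Labelling lab'
  pred< : pred (L w) < 2 * n
  pred< = subst (_≤ 2 * n) (sym (A.suc-pred-label w∈)) (A.bounded w∈)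
  wire : ∀ i → i < 2 * n → Wire
  wire i l = proj₁ (A.surjective i l)
  wire-inBox : ∀ i l → InBox n (wire i l)
  wire-inBox i l = proj₁ (proj₂ (A.surjective i l))
  label-wire : ∀ i l → L (wire i l) ≡ suc i
  label-wire i l = proj₂ (proj₂ (A.surjective i l))
  relabel : ∀ i → i < 2 * n → ℕ
  relabel i l = pred (L' (wire i l))
  relabel-mono : ∀ i j l l' → i < j → relabel i l < relabel j l'
  relabel-mono i j l l' i<j = s≤s⁻¹ (subst₂ _<_
    (sym (B.suc-pred-label (wire-inBox i l))) (sym (B.suc-pred-label (wire-inBox j l')))
    (B.mono (wire-inBox i l) (wire-inBox j l') (A.reflects (wire-inBox i l) (wire-inBox j l')
      (subst₂ _<_ (sym (label-wire i l)) (sym (label-wire j l')) (s≤s i<j)))))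
  relabel< : ∀ i l → relabel i l < 2 * n
  relabel< i l = subst (_≤ 2 * n) (sym (B.suc-pred-label (wire-inBox i l))) (B.bounded (wire-inBox i l))
  pred≡ : pred (L' w) ≡ pred (L w)
  pred≡ = trans
    (cong (pred ∘ L') (A.injective w∈ (wire-inBox _ pred<)
      (trans (sym (A.suc-pred-label w∈)) (sym (label-wire _ pred<)))))
    (increasing⇒identity (2 * n) relabel relabel< relabel-mono (pred (L w)) pred<)

-- The start of the path that leaves through a given step: the inverse of the permutation, read on
-- wires.
origin : (ℕ → ℕ → Bool) → ℕ → Wire → Wire
origin M n (hwire a) = hor M a n
origin M n (vwire b) = ver M n b

-- The symmetric tableau and its zigzag paths

module SymmetricTableau (n : ℕ) (T : Tab) (isPTB : IsPTB n T) where
  open IsPTB isPTB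

  rowLen-beyond : ∀ {a} → n ≤ a → rowLen T a ≡ 0
  rowLen-beyond {a} n≤a = cong length (nth-default [] (rows T) a (subst (_≤ a) (sym nrows) n≤a))

  rowLen-row<n : ∀ {a b} → b < rowLen T a → a < n
  rowLen-row<n {a} {b} l = ≰⇒> λ n≤a → <⇒≱ l (subst (_≤ b) (sym (rowLen-beyond n≤a)) z≤n)

  rowLen-col<k : ∀ {a b} → b ≤ a → b < rowLen T a → b < k T
  rowLen-col<k {a} {b} b≤a l with a <? k T
  ... | yes a<k = ≤-<-trans b≤a a<k
  ... | no a≮k  = <-≤-trans l (Fbounded a (≮⇒≥ a≮k) (rowLen-row<n l))

  rowLen-lower : ∀ {a b} → b < rowLen T a → b ≤ a
  rowLen-lower {a} {b} l with a <? k T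
  ... | yes a<k = s≤s⁻¹ (subst (b <_) (stair a a<k) l)
  ... | no a≮k  = <⇒≤ (<-≤-trans (<-≤-trans l (Fbounded a (≮⇒≥ a≮k) (rowLen-row<n l))) (≮⇒≥ a≮k))

  rowLen-diagonal : ∀ {a} → a < k T → a < rowLen T a
  rowLen-diagonal {a} a<k = ≤-reflexive (sym (stair a a<k))

  column-initial : ∀ {a i} → a ≤ i → a < rowLen T (suc i) → a < rowLen T i
  column-initial {a} {i} a≤i l with i <? k T
  ... | yes i<k = subst (a <_) (sym (stair i i<k)) (s≤s a≤i)
  ... | no i≮k  = <-≤-trans l (Fdecr i (≮⇒≥ i≮k) (rowLen-row<n l))

  private
    belowCount : ℕ → ℕ
    belowCount a = countB (λ b → a <ᵇ rowLen T b) (applyUpTo (λ t → suc a + t) (n ∸ suc a))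

    sRowLen-split : ∀ a → sRowLen n T a ≡ rowLen T a + belowCount a
    sRowLen-split a = cong (λ xs → rowLen T a + countB (λ b → a <ᵇ rowLen T b) xs)
                           (map-upTo (λ t → suc a + t) (n ∸ suc a))

    below-initial : ∀ a t → suc t < n ∸ suc a → (a <ᵇ rowLen T (suc a + suc t)) ≡ true →
      (a <ᵇ rowLen T (suc a + t)) ≡ true
    below-initial a t _ e = <ᵇ-true (column-initial (m≤n⇒m≤1+n (m≤m+n a t))
      (subst (λ x → a < rowLen T x) (cong suc (+-suc a t)) (<ᵇ-true⁻ e)))

  inS-low⁺ : ∀ {a b} → b < rowLen T a → inS n T a b ≡ true
  inS-low⁺ {a} {b} l = <ᵇ-true (subst (b <_) (sym (sRowLen-split a)) (<-≤-trans l (m≤m+n _ _)))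

  -- `sRowLen` adds the number of mirrored cells to the end of row `a` of `T`, which is the right
  -- place only if that row reaches the diagonal. It does: a cell mirrored into row `a` comes from
  -- column `a` of `T`, so `a < k T`, and the staircase gives row `a` the length `suc a`.
  inS-low⁻ : ∀ {a b} → b ≤ a → inS n T a b ≡ true → b < rowLen T a
  inS-low⁻ {a} {b} b≤a e with b <? rowLen T a
  ... | yes l = l
  ... | no ≮  with <ᵇ-true⁻ {b} {sRowLen n T a} e
  ...   | l rewrite sRowLen-split a with 0 <? belowCount a
  ...     | no z = contradiction (subst (b <_) (trans (cong (rowLen T a +_) (n≤0⇒n≡0 (≮⇒≥ z)))
      (+-identityʳ _)) l) ≮
  ...     | yes z with countB-initial⁻ (λ b → a <ᵇ rowLen T b) (λ t → suc a + t) (n ∸ suc a)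
      (below-initial a) 0 z
  ...       | _ , q = contradiction
    (subst (b <_) (sym (stair a (rowLen-col<k {suc a + 0} (m≤n⇒m≤1+n (m≤m+n a 0)) (<ᵇ-true⁻ q))))
        (s≤s b≤a)) ≮

  private
    high-index : ∀ {a b} → a < b → ∃ λ t → b ≡ suc a + t
    high-index {a} {b} l = b ∸ suc a , sym (m+[n∸m]≡n l)

  inS-high⁺ : ∀ {a b} → a < b → a < rowLen T b → inS n T a b ≡ true
  inS-high⁺ {a} {b} a<b l with high-index a<b
  ... | t , refl = <ᵇ-true (subst (suc a + t <_) (sym (sRowLen-split a))
    (subst (λ x → suc a + t < x + belowCount a) (sym (stair a (rowLen-col<k (<⇒≤ a<b) l)))
      (+-monoʳ-< (suc a) (countB-initial⁺ _ (λ t → suc a + t) (n ∸ suc a) (below-initial a) t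
        (t<n∸1+a (rowLen-row<n l)) (<ᵇ-true l)))))
    where
    t<n∸1+a : suc a + t < n → t < n ∸ suc a
    t<n∸1+a q = +-cancelˡ-< (suc a) t _ (subst (suc a + t <_)
        (sym (m+[n∸m]≡n (≤-trans (m≤m+n (suc a) t) (<⇒≤ q)))) q)

  inS-high⁻ : ∀ {a b} → a < b → inS n T a b ≡ true → a < rowLen T b
  inS-high⁻ {a} {b} a<b e with high-index a<b
  ... | t , refl with a <? k T
  ...   | yes a<k = <ᵇ-true⁻ (proj₂ (countB-initial⁻ _ (λ t → suc a + t) (n ∸ suc a) (below-initial a) t
      (+-cancelˡ-< (suc a) t _ (subst (λ x → suc a + t < x + belowCount a) (stair a a<k)
        (subst (suc a + t <_) (sRowLen-split a) (<ᵇ-true⁻ e))))))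
  ...   | no a≮k with <ᵇ-true⁻ {suc a + t} {sRowLen n T a} e
  ...     | l rewrite sRowLen-split a with 0 <? belowCount a
  ...       | yes z = contradiction (rowLen-col<k {suc a + 0} (m≤n⇒m≤1+n (m≤m+n a 0)) (<ᵇ-true⁻
      (proj₂ (countB-initial⁻ (λ b → a <ᵇ rowLen T b) (λ t → suc a + t) (n ∸ suc a)
          (below-initial a) 0 z)))) a≮k
  ...       | no z = contradiction (rowLen-col<k ≤-refl (<-trans a<b
      (subst (suc a + t <_) (trans (cong (rowLen T a +_) (n≤0⇒n≡0 (≮⇒≥ z))) (+-identityʳ _)) l))) a≮k

  inS-row<n : ∀ {a b} → inS n T a b ≡ true → a < n
  inS-row<n {a} {b} e with a <? b
  ... | yes a<b = <-trans a<b (rowLen-row<n (inS-high⁻ a<b e))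
  ... | no a≮b  = rowLen-row<n (inS-low⁻ (≮⇒≥ a≮b) e)

  inS-mirror : ∀ {a b} → inS n T a b ≡ true → inS n T b a ≡ true
  inS-mirror {a} {b} e with <-cmp a b
  ... | tri< a<b _ _    = inS-low⁺ (inS-high⁻ a<b e)
  ... | tri≈ _ refl _   = e
  ... | tri> _ _ b<a    = inS-high⁺ b<a (inS-low⁻ (<⇒≤ b<a) e)

  inS-symmetric : ∀ a b → inS n T a b ≡ inS n T b a
  inS-symmetric a b = bool-ext inS-mirror inS-mirror

  inS-bounded : ∀ {a b} → inS n T a b ≡ true → a < n × b < n
  inS-bounded e = inS-row<n e , inS-row<n (inS-mirror e)

  inS-left : ∀ {a b b'} → b' ≤ b → inS n T a b ≡ true → inS n T a b' ≡ true
  inS-left {a} {b} b'≤b e = <ᵇ-true (≤-<-trans b'≤b (<ᵇ-true⁻ {b} {sRowLen n T a} e))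

  inS-down : DownClosed (inS n T)
  inS-down a'≤a b'≤b e = inS-left b'≤b (inS-mirror (inS-left a'≤a (inS-mirror e)))

  inS⇒<sRowLen : ∀ {a b} → inS n T a b ≡ true → b < sRowLen n T a
  inS⇒<sRowLen {a} {b} = <ᵇ-true⁻ {b} {sRowLen n T a}

  sRowLen-≤ : ∀ a → sRowLen n T a ≤ n
  sRowLen-≤ a = ≮⇒≥ λ l → <-irrefl refl (proj₂ (inS-bounded {a} {n} (<ᵇ-true l)))

  sRowLen-antitone : ∀ {a a'} → a ≤ a' → sRowLen n T a' ≤ sRowLen n T a
  sRowLen-antitone {a} {a'} a≤a' = ≮⇒≥ λ l →
    <-irrefl refl (inS⇒<sRowLen {a} (inS-down a≤a' ≤-refl (<ᵇ-true {sRowLen n T a} l)))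

  sRowLen-mirror : ∀ {a c} → c < sRowLen n T a → a < sRowLen n T c
  sRowLen-mirror {a} {c} l = inS⇒<sRowLen {c} (inS-mirror {a} (<ᵇ-true l))

  sColLen≡sRowLen : ∀ c → sColLen n T c ≡ sRowLen n T c
  sColLen≡sRowLen c = <-ext
    (λ t l → sRowLen-mirror (<ᵇ-true⁻ (proj₂ (countB-initial⁻ _ id n initial t l))))
    (λ t l → countB-initial⁺ _ id n initial t (<-≤-trans l (sRowLen-≤ c)) (<ᵇ-true (sRowLen-mirror l)))
    where
    initial : ∀ t → suc t < n → inS n T (suc t) c ≡ true → inS n T t c ≡ true
    initial t _ e = inS-down (n≤1+n t) ≤-refl e

  label : Wire → ℕ
  label (hwire a) = rowLabel n T a
  label (vwire c) = colLabel n T c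

  -- Reflection in the diagonal reverses the boundary of T_s. With row length `λa` the labels are
  -- `(n ∸ λa) + a + 1` and `(n ∸ suc a) + λa + 1`, and in the sum `a` and `λa` cancel.
  label-mirror : ∀ {a} → a < n → rowLabel n T a + colLabel n T a ≡ suc (2 * n)
  label-mirror {a} a<n rewrite sColLen≡sRowLen a = cong suc (begin
    (n ∸ λa) + a + suc ((n ∸ suc a) + λa) ≡⟨ +-suc _ _ ⟩
    suc ((n ∸ λa) + a + ((n ∸ suc a) + λa)) ≡⟨ cong (λ x → suc (x + ((n ∸ suc a) + λa)))
        (+-comm (n ∸ λa) a) ⟩
    suc (a + (n ∸ λa) + ((n ∸ suc a) + λa)) ≡⟨ cong (λ x → suc (a + (n ∸ λa) + x))
        (+-comm (n ∸ suc a) λa) ⟩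
    suc (a + (n ∸ λa) + (λa + (n ∸ suc a))) ≡⟨ cong suc (+-assoc a _ _) ⟩
    suc (a + ((n ∸ λa) + (λa + (n ∸ suc a)))) ≡⟨ cong (λ x → suc (a + x)) (sym (+-assoc (n ∸ λa) λa _)) ⟩
    suc (a + ((n ∸ λa) + λa + (n ∸ suc a))) ≡⟨ cong (λ x → suc (a + (x + (n ∸ suc a))))
        (m∸n+n≡m (sRowLen-≤ a)) ⟩
    suc a + (n + (n ∸ suc a)) ≡⟨ cong (suc a +_) (+-comm n _) ⟩
    suc a + ((n ∸ suc a) + n) ≡⟨ sym (+-assoc (suc a) _ n) ⟩
    suc a + (n ∸ suc a) + n ≡⟨ cong (_+ n) (m+[n∸m]≡n a<n) ⟩
    n + n ≡⟨ n+n≡2*n n ⟩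
    2 * n ∎)
    where
    open ≡-Reasoning
    λa = sRowLen n T a

  label-isLabelling : IsLabelling n (inS n T) label
  label-isLabelling = record { mono = λ {w} {w'} → mono w w' ; positive = λ {w} → positive w ;
      bounded = λ {w} → bounded w }
    where
    mono : ∀ w w' → InBox n w → InBox n w' → Precedes (inS n T) w w' → label w < label w'
    mono (hwire a) (hwire a') _ _ a<a' = s≤s (+-mono-≤-< (∸-monoʳ-≤ n (sRowLen-antitone (<⇒≤ a<a')))
        a<a')
    mono (hwire a) (vwire c) _ _ e rewrite sColLen≡sRowLen c =
      s≤s (+-mono-≤-< (∸-monoʳ-≤ n (inS⇒<sRowLen {a} e)) (inS⇒<sRowLen {c} (inS-mirror {a} e)))
    mono (vwire c) (hwire a) c<n _ e rewrite sColLen≡sRowLen c =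
      s≤s (+-mono-<-≤ (∸-monoʳ-< {n} {suc c} {sRowLen n T a}
          (s≤s (≮⇒≥ λ l → true≢false (<ᵇ-true l) e)) c<n)
                      (≮⇒≥ λ l → true≢false (inS-mirror {c} (<ᵇ-true {a} {sRowLen n T c} l)) e))
    mono (vwire c) (vwire c') c<n _ c'<c rewrite sColLen≡sRowLen c | sColLen≡sRowLen c' =
      s≤s (+-mono-<-≤ (∸-monoʳ-< (s≤s c'<c) c<n) (sRowLen-antitone (<⇒≤ c'<c)))
    positive : ∀ w → InBox n w → 0 < label w
    positive (hwire a) _ = z<s
    positive (vwire c) _ = z<s
    bounded : ∀ w → InBox n w → label w ≤ 2 * n
    bounded (hwire a) a<n = subst (label (hwire a) ≤_) (n+n≡2*n n)
        (+-mono-≤-< (m∸n≤m n (sRowLen n T a)) a<n)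
    bounded (vwire c) c<n rewrite sColLen≡sRowLen c =
      subst (suc ((n ∸ suc c) + sRowLen n T c) ≤_) (n+n≡2*n n)
        (+-mono-<-≤ (∸-monoʳ-< z<s c<n) (sRowLen-≤ c))

  entryS-low : ∀ {a b} → b ≤ a → entryS T a b ≡ entry T a b
  entryS-low {a} {b} b≤a rewrite Equivalence.to T-≡ (≤⇒≤ᵇ b≤a) = refl

  entryS-high : ∀ {a b} → a ≤ b → entryS T a b ≡ entry T b a
  entryS-high {a} {b} a≤b with m≤n⇒m<n∨m≡n a≤b
  ... | inj₂ refl = entryS-low {a} {a} ≤-refl
  ... | inj₁ a<b with b ≤ᵇ a in e
  ...   | false = refl
  ...   | true  = contradiction (≤ᵇ⇒≤ b a (Equivalence.from T-≡ e)) (<⇒≱ a<b)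

  entryS-symmetric : ∀ a b → entryS T a b ≡ entryS T b a
  entryS-symmetric a b with ≤-total a b
  ... | inj₁ a≤b = trans (entryS-high a≤b) (sym (entryS-low a≤b))
  ... | inj₂ b≤a = trans (entryS-low b≤a) (sym (entryS-high b≤a))

  fill : ℕ → ℕ → Bool
  fill a b = inS n T a b ∧ entryS T a b

  fill-symmetric : ∀ a b → fill a b ≡ fill b a
  fill-symmetric a b = cong₂ _∧_ (inS-symmetric a b) (entryS-symmetric a b)

  fill-⊆ : fill ⊆ inS n T
  fill-⊆ {a} {b} e with inS n T a b
  ... | true = refl

  fill-inside : ∀ {a b} → inS n T a b ≡ true → fill a b ≡ entryS T a b
  fill-inside {a} {b} e = cong (_∧ entryS T a b) e

  fill-low : ∀ {a b} → b < rowLen T a → b ≤ a → fill a b ≡ entry T a b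
  fill-low {a} l b≤a = trans (fill-inside {a} (inS-low⁺ l)) (entryS-low b≤a)

  fill-low⁻ : ∀ {a b} → b ≤ a → fill a b ≡ true → entry T a b ≡ true
  fill-low⁻ {a} {b} b≤a e = trans (sym (fill-low (inS-low⁻ b≤a (fill-⊆ {a} e)) b≤a)) e

  fill-high⁻ : ∀ {a b} → a ≤ b → fill a b ≡ true → entry T b a ≡ true
  fill-high⁻ {a} {b} a≤b e = fill-low⁻ a≤b (trans (fill-symmetric b a) e)

  diagonal-one : ∀ {i j} → i < k T → j < i → entry T i j ≡ true → entry T i i ≡ true
  diagonal-one {i} {j} i<k j<i e = ¬-not λ z → diag i i<k z (j , j<i , e)

  -- In T_s the 1 above `(a , b)` may lie beyond the diagonal. It is then the mirror image of a 1 to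
  -- the left of the diagonal cell `(b , b)`, which is 1 by condition (3). For `b < a` this cell
  -- serves as the 1 above; for `b` equal to `a` it contradicts the 0.
  no-le-low : ∀ {a b a' b'} → b ≤ a → inS n T a b ≡ true → fill a b ≡ false →
    a' < a → fill a' b ≡ true → b' < b → ¬ fill a b' ≡ true
  no-le-low {a} {b} {a'} {b'} b≤a s z a'<a e b'<b f =
    noLe a b l z' ((proj₁ above , proj₁ (proj₂ above) , proj₂ (proj₂ above)) , b' , b'<b , left)
    where
    l : b < rowLen T a
    l = inS-low⁻ b≤a s
    z' : entry T a b ≡ false
    z' = trans (sym (fill-low l b≤a)) z
    left : entry T a b' ≡ true
    left = fill-low⁻ (<⇒≤ (<-≤-trans b'<b b≤a)) f
    above : ∃ λ i → i < a × entry T i b ≡ true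
    above with b ≤? a'
    ... | yes b≤a' = a' , a'<a , fill-low⁻ b≤a' e
    ... | no b≰a' with m≤n⇒m<n∨m≡n b≤a
    ...   | inj₁ b<a = b , b<a , diagonal-one (rowLen-col<k b≤a l) (≰⇒> b≰a')
        (fill-high⁻ (<⇒≤ (≰⇒> b≰a')) e)
    ...   | inj₂ refl = contradiction z' (true≢false (diagonal-one (rowLen-col<k b≤a l) b'<b left))

  no-le : ∀ {a b a' b'} → inS n T a b ≡ true → fill a b ≡ false →
    a' < a → fill a' b ≡ true → b' < b → ¬ fill a b' ≡ true
  no-le {a} {b} {a'} {b'} s z a'<a e b'<b f with ≤-total b a
  ... | inj₁ b≤a = no-le-low b≤a s z a'<a e b'<b f
  ... | inj₂ a≤b = no-le-low a≤b (inS-mirror {a} s) (trans (fill-symmetric b a) z)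
    b'<b (trans (fill-symmetric b' a) f) a'<a (trans (fill-symmetric b a') e)

  fill-le : LeFilling (inS n T) fill
  fill-le a b s z with search (fill a) b | search (λ a' → fill a' b) a
  ... | inj₂ none        | _                   = inj₁ (hor-start fill a b none)
  ... | inj₁ _           | inj₂ none           = inj₂ (ver-start fill a b none)
  ... | inj₁ (b' , l , f) | inj₁ (a' , l' , e) = contradiction f (no-le s z l' e l)

hor-cong : ∀ {M M'} → (∀ a b → M a b ≡ M' a b) → ∀ a b → hor M a b ≡ hor M' a b
ver-cong : ∀ {M M'} → (∀ a b → M a b ≡ M' a b) → ∀ a b → ver M a b ≡ ver M' a b
hor-cong eq a zero = refl
hor-cong {M} {M'} eq a (suc b) rewrite eq a b with M' a b
... | true  = ver-cong eq a b
... | false = hor-cong eq a b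
ver-cong eq zero b = refl
ver-cong {M} {M'} eq (suc a) b rewrite eq a b with M' a b
... | true  = hor-cong eq a b
... | false = ver-cong eq a b

reach-row : ∀ {S e i} → Reach S e (hwire i) → e ≡ hwire i ⊎ Precedes S (hwire i) e
reach-row {S} {hwire a} i≤a with m≤n⇒m<n∨m≡n i≤a
... | inj₁ i<a  = inj₂ i<a
... | inj₂ refl = inj₁ refl
reach-row {S} {vwire j} s = inj₂ s

reach-col : ∀ {S e j} → Reach S e (vwire j) → e ≡ vwire j ⊎ Precedes S e (vwire j)
reach-col {S} {vwire b} j≤b with m≤n⇒m<n∨m≡n j≤b
... | inj₁ j<b  = inj₂ j<b
... | inj₂ refl = inj₁ refl
reach-col {S} {hwire a} s = inj₂ s

-- Rows are weak excedances and columns weak anti-excedances; the fixed points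
-- come from the empty rows of F and from their mirror columns.
RowLabel : ℕ → (ℕ → ℕ) → ℕ → Set
RowLabel n p i = i < p i ⊎ (i ≡ p i × n < i)

mirror-inBox : ∀ {n} w → InBox n w → InBox n (mirror w)
mirror-inBox (hwire a) l = l
mirror-inBox (vwire b) l = l

-- The permutation defined by the zigzag paths.

module Exits (n : ℕ) (T : Tab) (isPTB : IsPTB n T) where
  open IsPTB isPTB
  open SymmetricTableau n T isPTB public
  open Labelling label-isLabelling public hiding (mono)
  open Paths (inS n T) inS-down

  line : Dir → ℕ → ℕ → Wire
  line east  a b = hwire a
  line south a b = vwire b

  edge : Dir → ℕ → ℕ → Wire
  edge east  = hor fill
  edge south = ver fill

  advance : ℕ → Dir → ℕ → ℕ → ℕ
  advance f east  a b = walk n T f east a (suc b)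
  advance f south a b = walk n T f south (suc a) b

  turn : ℕ → ℕ → Dir → Dir
  turn a b d = if entryS T a b then flip d else d

  walk-outside : ∀ f d a b → inS n T a b ≡ false → walk n T (suc f) d a b ≡ label (line d a b)
  walk-outside f east  a b e rewrite e = refl
  walk-outside f south a b e rewrite e = refl

  walk-inside : ∀ f d a b → inS n T a b ≡ true →
    walk n T (suc f) d a b ≡ advance f (turn a b d) a b
  walk-inside f east a b e rewrite e with entryS T a b
  ... | true  = refl
  ... | false = refl
  walk-inside f south a b e rewrite e with entryS T a b
  ... | true  = refl
  ... | false = refl

  OnEdge : Dir → ℕ → ℕ → Set
  OnEdge d a b = a ≤ n × b ≤ n × InBox n (line d a b)

  -- Each step lowers the fuel by one and raises `a + b` by one. A path stays in the closed box,
  -- where `a + b ≤ 2 * n`, so the initial fuel `suc (2 * n)` is never exhausted.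
  out-of-fuel : ∀ {d a b} → OnEdge d a b → ¬ 2 * n < a + b
  out-of-fuel {d} {a} {b} (a≤n , b≤n , _) l =
    <⇒≱ l (subst (a + b ≤_) (n+n≡2*n n) (+-mono-≤ a≤n b≤n))

  turn-flip : ∀ a b d → turn b a (flip d) ≡ flip (turn a b d)
  turn-flip a b d rewrite entryS-symmetric b a with entryS T a b
  ... | true  = refl
  ... | false = refl

  -- Shape and filling are symmetric, so walks begun as mirror images stay mirror images and leave
  -- through mirror steps; `label-mirror` adds up their labels.
  walk-mirror : ∀ f d a b → 2 * n < f + (a + b) → OnEdge d a b →
    walk n T f d a b + walk n T f (flip d) b a ≡ suc (2 * n)
  walk-mirror zero d a b fuel on = contradiction fuel (out-of-fuel {d} {a} {b} on)
  walk-mirror (suc f) d a b fuel on@(_ , _ , inb) = go (inS n T a b) refl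
    where
    stop : ∀ d → InBox n (line d a b) → label (line d a b) + label (line (flip d) b a) ≡ suc (2 * n)
    stop east  l = label-mirror l
    stop south l = trans (+-comm (colLabel n T b) _) (label-mirror l)
    fuel' : 2 * n < f + (a + suc b)
    fuel' = subst (2 * n <_) (trans (sym (+-suc f _)) (cong (f +_) (sym (+-suc a b)))) fuel
    continue : ∀ d → inS n T a b ≡ true → advance f d a b + advance f (flip d) b a ≡ suc (2 * n)
    continue east  s = walk-mirror f east a (suc b) fuel'
      (<⇒≤ (proj₁ (inS-bounded s)) , proj₂ (inS-bounded s) , proj₁ (inS-bounded s))
    continue south s = walk-mirror f south (suc a) b
      (subst (λ x → 2 * n < f + x) (+-suc a b) fuel')
      (proj₁ (inS-bounded s) , <⇒≤ (proj₂ (inS-bounded s)) , proj₂ (inS-bounded s))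
    go : ∀ x → inS n T a b ≡ x → walk n T (suc f) d a b + walk n T (suc f) (flip d) b a ≡ suc (2 * n)
    go false e = trans (cong₂ _+_ (walk-outside f d a b e)
      (walk-outside f (flip d) b a (trans (inS-symmetric b a) e))) (stop d inb)
    go true  e = trans (cong₂ _+_ (walk-inside f d a b e)
      (trans (walk-inside f (flip d) b a (inS-mirror e))
          (cong (λ d → advance f d b a) (turn-flip a b d))))
      (continue (turn a b d) e)

  fill-outside : ∀ {a b} → inS n T a b ≡ false → fill a b ≡ false
  fill-outside {a} {b} e = cong (_∧ entryS T a b) e

  -- Outside the shape `fill` is 0, so a path that has left the shape runs straight to the side of
  -- the box: the boundary step and the end of its wire see the same path.
  origin-line : ∀ d a b → a ≤ n → b ≤ n → inS n T a b ≡ false → origin fill n (line d a b) ≡ edge d a b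
  origin-line east a b _ b≤n e = trans (cong (hor fill a) (sym (m+[n∸m]≡n b≤n)))
    (hor-const fill a b (n ∸ b) (λ i → fill-outside (¬-not (λ t →
      true≢false (inS-down ≤-refl (m≤m+n b i) t) e))))
  origin-line south a b a≤n _ e = trans (cong (λ x → ver fill x b) (sym (m+[n∸m]≡n a≤n)))
    (ver-const fill a b (n ∸ a) (λ i → fill-outside (¬-not (λ t →
      true≢false (inS-down (m≤m+n a i) ≤-refl t) e))))

  -- `walk` goes forwards while `hor` and `ver` look backwards. They meet in an invariant: every
  -- step of the walk preserves the start recorded on the edge being traversed.
  walk-exit : ∀ f d a b → 2 * n < f + (a + b) → OnEdge d a b →
    ∃ λ e → InBox n e × walk n T f d a b ≡ label e × origin fill n e ≡ edge d a b
  walk-exit zero d a b fuel on = contradiction fuel (out-of-fuel {d} {a} {b} on)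
  walk-exit (suc f) d a b fuel (a≤n , b≤n , inb) = go (inS n T a b) refl
    where
    fuel' : 2 * n < f + (a + suc b)
    fuel' = subst (2 * n <_) (trans (sym (+-suc f _)) (cong (f +_) (sym (+-suc a b)))) fuel
    afterCell : Dir → Wire
    afterCell east  = hor fill a (suc b)
    afterCell south = ver fill (suc a) b
    edge-turn : ∀ d → inS n T a b ≡ true → afterCell (turn a b d) ≡ edge d a b
    edge-turn d s with entryS T a b in e
    edge-turn east  s | true  = ver-turn fill a b (trans (fill-inside s) e)
    edge-turn south s | true  = hor-turn fill a b (trans (fill-inside s) e)
    edge-turn east  s | false = hor-pass fill a b (trans (fill-inside s) e)
    edge-turn south s | false = ver-pass fill a b (trans (fill-inside s) e)
    continue : ∀ d → inS n T a b ≡ true →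
      ∃ λ e → InBox n e × advance f d a b ≡ label e × origin fill n e ≡ afterCell d
    continue east  s = walk-exit f east a (suc b) fuel'
      (<⇒≤ (proj₁ (inS-bounded s)) , proj₂ (inS-bounded s) , proj₁ (inS-bounded s))
    continue south s = walk-exit f south (suc a) b
      (subst (λ x → 2 * n < f + x) (+-suc a b) fuel')
      (proj₁ (inS-bounded s) , <⇒≤ (proj₂ (inS-bounded s)) , proj₂ (inS-bounded s))
    go : ∀ x → inS n T a b ≡ x →
      ∃ λ e → InBox n e × walk n T (suc f) d a b ≡ label e × origin fill n e ≡ edge d a b
    go false s = line d a b , inb , walk-outside f d a b s , origin-line d a b a≤n b≤n s
    go true  s with continue (turn a b d) s
    ... | e , e∈ , w , o = e , e∈ , trans (walk-inside f d a b s) w , trans o (edge-turn d s)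

  π : ℕ → ℕ
  π = pathExit n T

  pathExit-row : ∀ i a → a < n → rowLabel n T a ≡ i → π i ≡ walk n T (suc (2 * n)) east a 0
  pathExit-row i a a<n e with findIdx (λ a → rowLabel n T a ≡ᵇ i) (upTo n) in found
  ... | nothing = contradiction (findIdx-nothing _ (upTo n) found (∈-upTo⁺ a<n))
                                (true≢false (Equivalence.to T-≡ (≡⇒≡ᵇ _ _ e)))
  ... | just a' with findIdx-just _ (upTo n) found
  ...   | a'∈ , e' = cong (λ x → walk n T (suc (2 * n)) east x 0)
    (hwire-injective (injective (∈-upTo⁻ a'∈) a<n (trans (≡ᵇ⇒≡ _ _ (Equivalence.from T-≡ e')) (sym e))))

  pathExit-col : ∀ i c → c < n → colLabel n T c ≡ i → π i ≡ walk n T (suc (2 * n)) south 0 c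
  pathExit-col i c c<n e with findIdx (λ a → rowLabel n T a ≡ᵇ i) (upTo n) in found
  ... | just a' = contradiction
        (injective {hwire a'} {vwire c} (∈-upTo⁻ (proj₁ (findIdx-just _ (upTo n) found))) c<n
          (trans (≡ᵇ⇒≡ _ _ (Equivalence.from T-≡ (proj₂ (findIdx-just _ (upTo n) found)))) (sym e))) λ ()
  ... | nothing with findIdx (λ c → colLabel n T c ≡ᵇ i) (upTo n) in found'
  ...   | nothing = contradiction (findIdx-nothing _ (upTo n) found' (∈-upTo⁺ c<n))
                                (true≢false (Equivalence.to T-≡ (≡⇒≡ᵇ _ _ e)))
  ...   | just c' with findIdx-just _ (upTo n) found'
  ...     | c'∈ , e' = cong (λ x → walk n T (suc (2 * n)) south 0 x)
    (vwire-injective (injective (∈-upTo⁻ c'∈) c<n (trans (≡ᵇ⇒≡ _ _ (Equivalence.from T-≡ e')) (sym e))))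

  exit : ∀ w → InBox n w → ∃ λ e → InBox n e × π (label w) ≡ label e × origin fill n e ≡ w
  exit (hwire a) a<n with walk-exit (suc (2 * n)) east a 0 (m≤m+n _ _) (<⇒≤ a<n , z≤n , a<n)
  ... | e , e∈ , w , o = e , e∈ , trans (pathExit-row _ a a<n refl) w , o
  exit (vwire c) c<n with walk-exit (suc (2 * n)) south 0 c (m≤m+n _ _) (z≤n , <⇒≤ c<n , c<n)
  ... | e , e∈ , w , o = e , e∈ , trans (pathExit-col _ c c<n refl) w , o

  π-mirror : ∀ w → InBox n w → π (label w) + π (label (mirror w)) ≡ suc (2 * n)
  π-mirror (hwire a) a<n = trans (cong₂ _+_ (pathExit-row _ a a<n refl) (pathExit-col _ a a<n refl))
    (walk-mirror (suc (2 * n)) east a 0 (m≤m+n _ _) (<⇒≤ a<n , z≤n , a<n))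
  π-mirror (vwire c) c<n = trans (cong₂ _+_ (pathExit-col _ c c<n refl) (pathExit-row _ c c<n refl))
    (walk-mirror (suc (2 * n)) south 0 c (m≤m+n _ _) (z≤n , <⇒≤ c<n , c<n))

  label-mirror-wire : ∀ w → InBox n w → label w + label (mirror w) ≡ suc (2 * n)
  label-mirror-wire (hwire a) l = label-mirror l
  label-mirror-wire (vwire c) l = trans (+-comm (label (vwire c)) _) (label-mirror l)

  origin-reach : ∀ e → Reach (inS n T) e (origin fill n e)
  origin-reach (hwire a) with hor fill a n | hor-from fill fill-⊆ a n
  ... | hwire i | i≤a     = i≤a
  ... | vwire j | (_ , s) = s
  origin-reach (vwire b) with ver fill n b | ver-from fill fill-⊆ n b
  ... | hwire i | (_ , s) = s
  ... | vwire j | j≤b     = j≤b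

  π-range : ∀ i → i < 2 * n → 0 < π (suc i) × π (suc i) ≤ 2 * n
  π-range i l with surjective i l
  ... | w , w∈ , e with exit w w∈
  ...   | x , x∈ , ex , _ = subst (0 <_) (sym (trans (cong π (sym e)) ex)) (positive x∈)
                          , subst (_≤ 2 * n) (sym (trans (cong π (sym e)) ex)) (bounded x∈)

  suc-pred-π : ∀ j → j < 2 * n → suc (pred (π (suc j))) ≡ π (suc j)
  suc-pred-π j l with π (suc j) | proj₁ (π-range j l)
  ... | suc _ | _ = refl

  π-injective : ∀ i j → i < 2 * n → j < 2 * n → π (suc i) ≡ π (suc j) → i ≡ j
  π-injective i j l l' eq with surjective i l | surjective j l'
  ... | w , w∈ , e | w' , w'∈ , e' with exit w w∈ | exit w' w'∈
  ...   | x , x∈ , ex , ox | x' , x'∈ , ex' , ox'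
    with injective x∈ x'∈ (trans (sym ex) (trans (cong π e) (trans eq (trans (cong π (sym e')) ex'))))
  ...   | refl = suc-injective (trans (sym e) (trans (cong label (trans (sym ox) ox')) e'))

  abstract
    π-surjective : ∀ i → i < 2 * n → ∃ λ j → j < 2 * n × π (suc j) ≡ suc i
    π-surjective i l with injective⇒surjective (2 * n) (λ j _ → pred (π (suc j)))
        (λ j l → subst (_≤ 2 * n) (sym (suc-pred-π j l)) (proj₂ (π-range j l)))
        (λ j j' l l' e → π-injective j j' l l' (trans (sym (suc-pred-π j l))
            (trans (cong suc e) (suc-pred-π j' l'))))
        i l
    ... | j , l' , e = j , l' , trans (sym (suc-pred-π j l')) (cong suc e)

  entrance : ∀ e → InBox n e → ∃ λ w → InBox n w × π (label w) ≡ label e × origin fill n e ≡ w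
  entrance e e∈ with π-surjective (pred (label e)) (subst (_≤ 2 * n) (sym (suc-pred-label e∈))
      (bounded e∈))
  ... | j , l , ej with surjective j l
  ...   | w , w∈ , ew with exit w w∈
  ...     | x , x∈ , ex , ox with injective x∈ e∈
      (trans (sym ex) (trans (cong π ew) (trans ej (suc-pred-label e∈))))
  ...       | refl = w , w∈ , ex , ox

  -- For `a < k T`, condition (1) gives a 1 in column `a` of `T`, whose mirror image lies in row `a`
  -- of T_s and would turn the path. So `a` is at least `k T`, the row stops before the diagonal,
  -- and `sRowLen n T a ≤ a` makes the label exceed `n`.
  empty-row-label : ∀ a → a < n → hor fill a n ≡ hwire a → n < label (hwire a)
  empty-row-label a a<n h = s≤s (≤-trans (m≤n+m∸n n (sRowLen n T a))
    (≤-trans (+-monoˡ-≤ (n ∸ sRowLen n T a) short) (≤-reflexive (+-comm a _))))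
    where
    a≮k : ¬ a < k T
    a≮k a<k with colOne a a<k
    ... | r , l , e with a ≤? r
    ...   | yes a≤r = contradiction (hor-unturned fill fill-⊆ a n h r (rowLen-row<n l))
                        (true≢false (trans (fill-symmetric a r) (trans (fill-low l a≤r) e)))
    ...   | no a≰r = a≰r (s≤s⁻¹ (subst (a <_) (stair r (<-trans (≰⇒> a≰r) a<k)) l))
    short : sRowLen n T a ≤ a
    short = ≮⇒≥ λ l → a≮k (rowLen-col<k ≤-refl (inS-low⁻ ≤-refl (<ᵇ-true {a} {sRowLen n T a} l)))

  empty-col-label : ∀ c → c < n → ver fill n c ≡ vwire c → ¬ n < label (vwire c)
  empty-col-label c c<n v l = <-irrefl (sym (label-mirror c<n))
    (subst (_≤ rowLabel n T c + colLabel n T c) (cong suc (trans (+-suc n n) (cong suc (n+n≡2*n n))))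
      (+-mono-≤ (empty-row-label c c<n h) l))
    where
    h : hor fill c n ≡ hwire c
    h = trans (hor-cong fill-symmetric c n) (trans (hor-mirror fill c n) (cong mirror v))

  -- Together with `col-notRowLabel` this recovers the set of row labels, and with it the shape,
  -- from `π` alone.
  row-isRowLabel : ∀ a → a < n → RowLabel n π (label (hwire a))
  row-isRowLabel a a<n with exit (hwire a) a<n
  ... | e , e∈ , ee , oe with reach-row (subst (Reach (inS n T) e) oe (origin-reach e))
  ...   | inj₂ p    = inj₁ (subst (label (hwire a) <_) (sym ee)
      (IsLabelling.mono label-isLabelling a<n e∈ p))
  ...   | inj₁ refl = inj₂ (sym ee , empty-row-label a a<n oe)

  col-notRowLabel : ∀ c → c < n → ¬ RowLabel n π (label (vwire c))
  col-notRowLabel c c<n r with exit (vwire c) c<n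
  ... | e , e∈ , ee , oe with reach-col (subst (Reach (inS n T) e) oe (origin-reach e)) | r
  ...   | inj₂ p    | inj₁ l = <-asym l (subst (_< label (vwire c)) (sym ee)
      (IsLabelling.mono label-isLabelling e∈ c<n p))
  ...   | inj₂ p    | inj₂ (q , _) = <-irrefl (trans (sym ee) (sym q))
      (IsLabelling.mono label-isLabelling e∈ c<n p)
  ...   | inj₁ refl | inj₁ l = <-irrefl (sym ee) l
  ...   | inj₁ refl | inj₂ (_ , l) = empty-col-label c c<n oe l

  rowLabel-increasing : ∀ a b → a < b → b < n → rowLabel n T a < rowLabel n T b
  rowLabel-increasing a b a<b b<n = IsLabelling.mono label-isLabelling {hwire a} {hwire b}
      (<-trans a<b b<n) b<n a<b

-- The image lies in the symmetric permutations.

toList-tabulate : ∀ {A : Set} (f : ℕ → A) m → toList (tabulate {n = m} (f ∘ toℕ)) ≡ applyUpTo f m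
toList-tabulate f zero    = refl
toList-tabulate f (suc m) = cong (f 0 ∷_) (toList-tabulate (f ∘ suc) m)

ΦB-isSP : ∀ n T → IsPTB n T → IsSP n (ΦB n T)
ΦB-isSP n T t = record { perm = perm ; symm = symm }
  where
  open Exits n T t
  perm : toList (ΦB n T) ↭ map suc (upTo (2 * n))
  perm rewrite toList-tabulate (π ∘ suc) (2 * n) | map-upTo suc (2 * n) = unique-set⇒↭
    (Unique.applyUpTo⁺₁ (π ∘ suc) (2 * n) (λ i<j j<m e → <⇒≢ i<j (π-injective _ _ (<-trans i<j j<m)
        j<m e)))
    (Unique.applyUpTo⁺₁ suc (2 * n) (λ i<j _ e → <⇒≢ i<j (suc-injective e)))
    to from
    where
    to : ∀ {x} → x ∈ applyUpTo (π ∘ suc) (2 * n) → x ∈ applyUpTo suc (2 * n)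
    to x∈ with ∈-applyUpTo⁻ (π ∘ suc) x∈
    ... | i , l , refl with π (suc i) | π-range i l
    ...   | suc j | _ , j< = ∈-applyUpTo⁺ suc j<
    from : ∀ {x} → x ∈ applyUpTo suc (2 * n) → x ∈ applyUpTo (π ∘ suc) (2 * n)
    from x∈ with ∈-applyUpTo⁻ suc x∈
    ... | i , l , refl with π-surjective i l
    ...   | j , l' , e = subst (_∈ applyUpTo (π ∘ suc) (2 * n)) e (∈-applyUpTo⁺ (π ∘ suc) l')
  symm : ∀ i → lookup (ΦB n T) i + lookup (ΦB n T) (opposite i) ≡ suc (2 * n)
  symm i rewrite lookup∘tabulate (λ i → π (suc (toℕ i))) i
               | lookup∘tabulate (λ i → π (suc (toℕ i))) (opposite i)
               | Fin.opposite-prop i with surjective (toℕ i) (Fin.toℕ<n i)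
  ... | w , w∈ , e = subst₂ (λ x y → π x + π y ≡ suc (2 * n)) e e' (π-mirror w w∈)
    where
    e' : label (mirror w) ≡ suc (2 * n ∸ suc (toℕ i))
    e' = +-cancelˡ-≡ (label w) _ _ (trans (label-mirror-wire w w∈)
      (trans (cong suc (sym (m+[n∸m]≡n (Fin.toℕ<n i)))) (trans (sym (+-suc (suc (toℕ i)) _))
          (cong (_+ suc (2 * n ∸ suc (toℕ i))) (sym e)))))

-- Injectivity: recovery of the shape and of the filling.

module Injectivity (n : ℕ) (T T' : Tab) (t : IsPTB n T) (t' : IsPTB n T')
  (same : ∀ i → i < 2 * n → pathExit n T (suc i) ≡ pathExit n T' (suc i)) where
  private
    module A = Exits n T t
    module B = Exits n T' t'

  π-same : ∀ {i} → 0 < i → i ≤ 2 * n → A.π i ≡ B.π i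
  π-same {suc i} _ l = same i l

  -- `RowLabel` depends on the permutation only, so a row label of `T` cannot be a column label of
  -- `T'`. It is therefore a row label of `T'`, and increasing enumerations of the same `n` labels
  -- agree.
  rowLabel≡ : ∀ a → a < n → rowLabel n T a ≡ rowLabel n T' a
  rowLabel≡ = increasing-enumeration-unique n (rowLabel n T) (rowLabel n T')
    A.rowLabel-increasing B.rowLabel-increasing find
    where
    find : ∀ a → a < n → ∃ λ a' → a' < n × rowLabel n T' a' ≡ rowLabel n T a
    find a a<n with B.surjective (pred (rowLabel n T a)) (A.bounded {hwire a} a<n)
    ... | hwire a' , l , e = a' , l , e
    ... | vwire c  , l , e = contradiction
      (subst₂ (λ x y → x < y ⊎ (x ≡ y × n < x)) (sym e)
        (trans (π-same z<s (A.bounded {hwire a} a<n)) (cong B.π (sym e)))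
        (A.row-isRowLabel a a<n))
      (B.col-notRowLabel c l)

  sRowLen≡ : ∀ a → a < n → sRowLen n T a ≡ sRowLen n T' a
  sRowLen≡ a a<n = ∸-cancelˡ-≡ (A.sRowLen-≤ a) (B.sRowLen-≤ a)
    (+-cancelʳ-≡ a _ _ (suc-injective (rowLabel≡ a a<n)))

  inS→ : ∀ {a b} → inS n T a b ≡ true → inS n T' a b ≡ true
  inS→ {a} {b} s = trans (cong (b <ᵇ_) (sym (sRowLen≡ a (proj₁ (A.inS-bounded s))))) s

  inS← : ∀ {a b} → inS n T' a b ≡ true → inS n T a b ≡ true
  inS← {a} {b} s = trans (cong (b <ᵇ_) (sRowLen≡ a (proj₁ (B.inS-bounded s)))) s

  label≡ : ∀ w → InBox n w → A.label w ≡ B.label w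
  label≡ (hwire a) a<n = rowLabel≡ a a<n
  label≡ (vwire c) c<n = +-cancelˡ-≡ (rowLabel n T c) _ _ (trans (A.label-mirror c<n)
    (trans (sym (B.label-mirror c<n)) (cong (_+ colLabel n T' c) (sym (rowLabel≡ c c<n)))))

  origin≡ : ∀ e → InBox n e → origin A.fill n e ≡ origin B.fill n e
  origin≡ e e∈ with A.entrance e e∈
  ... | w , w∈ , p , o with B.exit w w∈
  ...   | e' , e'∈ , p' , o' = trans o (trans (sym o') (cong (origin B.fill n) e'≡e))
    where
    e'≡e : e' ≡ e
    e'≡e = B.injective e'∈ e∈ (trans (sym p') (trans (cong B.π (sym (label≡ w w∈)))
      (trans (sym (π-same (A.positive w∈) (A.bounded w∈))) (trans p (label≡ e e∈)))))

  fill≡ : ∀ a b → a < n → b < n → A.fill a b ≡ B.fill a b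
  fill≡ = Paths.LeFilling-unique (inS n T) A.inS-down n A.fill B.fill
    (λ {a} → A.fill-⊆ {a}) (λ {a} e → inS← {a} (B.fill-⊆ {a} e)) A.fill-le
    (λ a b s → B.fill-le a b (inS→ {a} s)) (λ a → origin≡ (hwire a)) (λ b → origin≡ (vwire b))

  -- `a < k T` holds exactly when the diagonal cell `(a , a)` belongs to T_s.
  k≡ : k T ≡ k T'
  k≡ = <-ext
    (λ a a<k → B.rowLen-col<k ≤-refl (B.inS-low⁻ ≤-refl (inS→ {a} (A.inS-low⁺ (A.rowLen-diagonal a<k)))))
    (λ a a<k → A.rowLen-col<k ≤-refl (A.inS-low⁻ ≤-refl (inS← {a} (B.inS-low⁺ (B.rowLen-diagonal a<k)))))

  row≡ : ∀ a → row T a ≡ row T' a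
  row≡ a = nth-ext false (row T a) (row T' a)
    (<-ext (λ b l → B.inS-low⁻ (A.rowLen-lower l) (inS→ {a} (A.inS-low⁺ l)))
           (λ b l → A.inS-low⁻ (B.rowLen-lower l) (inS← {a} (B.inS-low⁺ l))))
    (λ b l → trans (sym (A.fill-low l (A.rowLen-lower l)))
      (trans (fill≡ a b (A.rowLen-row<n l) (≤-<-trans (A.rowLen-lower l) (A.rowLen-row<n l)))
        (B.fill-low (B.inS-low⁻ (A.rowLen-lower l) (inS→ {a} (A.inS-low⁺ l))) (A.rowLen-lower l))))

  tableau≡ : T ≡ T'
  tableau≡ = cong₂ mkTab k≡ (nth-ext [] (rows T) (rows T')
    (trans (IsPTB.nrows t) (sym (IsPTB.nrows t'))) (λ a _ → row≡ a))

ΦB-injective : ∀ n T T' → IsPTB n T → IsPTB n T' → ΦB n T ≡ ΦB n T' → T ≡ T'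
ΦB-injective n T T' t t' eq = Injectivity.tableau≡ n T T' t t' same
  where
  same : ∀ i → i < 2 * n → pathExit n T (suc i) ≡ pathExit n T' (suc i)
  same i l = subst (λ i → pathExit n T (suc i) ≡ pathExit n T' (suc i)) (Fin.toℕ-fromℕ< l)
    (trans (sym (lookup∘tabulate (λ i → pathExit n T (suc (toℕ i))) (fromℕ< l)))
      (trans (cong (λ v → lookup v (fromℕ< l)) eq)
        (lookup∘tabulate (λ i → pathExit n T' (suc (toℕ i))) (fromℕ< l))))

-- p is a symmetric permutation of {1,…,2n}; its values elsewhere are junk.
record IsSymmetricPermutation (n : ℕ) (p : ℕ → ℕ) : Set where
  field
    range      : ∀ {i} → 0 < i → i ≤ 2 * n → 0 < p i × p i ≤ 2 * n
    injective  : ∀ {i j} → 0 < i → i ≤ 2 * n → 0 < j → j ≤ 2 * n → p i ≡ p j → i ≡ j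
    surjective : ∀ {i} → 0 < i → i ≤ 2 * n → ∃ λ j → j < 2 * n × p (suc j) ≡ i
    symmetric  : ∀ {i j} → 0 < i → 0 < j → i + j ≡ suc (2 * n) → p i + p j ≡ suc (2 * n)

-- The tableau of a symmetric permutation

does-true : ∀ {P : Set} (d : Dec P) → does d ≡ true → P
does-true (yes x) _ = x

sum-reverses-< : ∀ {i j i' j' m} → i + j ≡ m → i' + j' ≡ m → i < i' → j' < j
sum-reverses-< {i} {j} {i'} {j'} e e' l =
  ≰⇒> λ j≤j' → <-irrefl (trans e (sym e')) (+-mono-<-≤ l j≤j')

sum-determines : ∀ {i j j' m} → i + j ≡ m → i + j' ≡ m → j ≡ j'
sum-determines {i} e e' = +-cancelˡ-≡ i _ _ (trans e (sym e'))

module Surjectivity (n : ℕ) (p : ℕ → ℕ) (isSP : IsSymmetricPermutation n p) where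
  open IsSymmetricPermutation isSP

  N = suc (2 * n)

  Row : ℕ → Set
  Row = RowLabel n p

  row? : ∀ i → Dec (Row i)
  row? i = (i <? p i) ⊎-dec ((i ≟ p i) ×-dec (n <? i))

  1+n+1+n : suc n + suc n ≡ suc N
  1+n+1+n = cong suc (trans (+-suc n n) (cong suc (n+n≡2*n n)))

  -- Reflection exchanges strict excedances with strict deficiencies. Two mirror fixed points add up
  -- to `N`, so exactly one of them exceeds `n`, and the tie-break in `RowLabel` picks that one.
  row-mirror : ∀ {i j} → 0 < i → 0 < j → i + j ≡ N → Row i → ¬ Row j
  row-mirror 0<i 0<j e (inj₁ l) (inj₁ l') = <-asym l' (sum-reverses-< e (symmetric 0<i 0<j e) l)
  row-mirror 0<i 0<j e (inj₁ l) (inj₂ (q , _)) = <-irrefl (sym q)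
      (sum-reverses-< e (symmetric 0<i 0<j e) l)
  row-mirror {i} {j} 0<i 0<j e (inj₂ (q , _)) (inj₁ l') =
    <-irrefl (sum-determines e (subst (λ x → x + p j ≡ N) (sym q) (symmetric 0<i 0<j e))) l'
  row-mirror 0<i 0<j e (inj₂ (_ , l)) (inj₂ (_ , l')) =
    <⇒≱ (n<1+n N) (≤-trans (≤-reflexive (sym 1+n+1+n)) (≤-trans (+-mono-≤ l l') (≤-reflexive e)))

  ¬row-mirror : ∀ {i j} → 0 < i → 0 < j → i + j ≡ N → ¬ Row i → Row j
  ¬row-mirror {i} {j} 0<i 0<j e r with <-cmp i (p i)
  ... | tri< l _ _ = contradiction (inj₁ l) r
  ... | tri> _ _ l = inj₁ (sum-reverses-< (symmetric 0<i 0<j e) e l)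
  ... | tri≈ _ q _ = inj₂ (sum-determines e (subst (λ x → x + p j ≡ N) (sym q) (symmetric 0<i 0<j e))
    , ≰⇒> λ j≤n → <-irrefl e (≤-<-trans (+-mono-≤ (≮⇒≥ λ l → r (inj₂ (q , l))) j≤n)
        (s≤s (≤-reflexive (n+n≡2*n n)))))

  rowLabels : List ℕ
  rowLabels = filter row? (applyUpTo suc (2 * n))

  labels-increasing : AllPairs (λ i j → i < j × j ≤ 2 * n) (applyUpTo suc (2 * n))
  labels-increasing = AllPairs.applyUpTo⁺₁ suc (2 * n) (λ i<j j< → s≤s i<j , j<)

  rowLabels-increasing : AllPairs (λ i j → i < j × j ≤ 2 * n) rowLabels
  rowLabels-increasing = AllPairs.filter⁺ row? labels-increasing

  rowLabels⁻ : ∀ {i} → i ∈ rowLabels → (0 < i × i ≤ 2 * n) × Row i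
  rowLabels⁻ i∈ with ∈-filter⁻ row? {xs = applyUpTo suc (2 * n)} i∈
  ... | i∈' , r with ∈-applyUpTo⁻ suc i∈'
  ...   | j , l , refl = (z<s , l) , r

  rowLabels⁺ : ∀ {i} → 0 < i → i ≤ 2 * n → Row i → i ∈ rowLabels
  rowLabels⁺ {suc i} _ l r = ∈-filter⁺ row? (∈-applyUpTo⁺ suc l) r

  mirror-positive : ∀ {i} → i ≤ 2 * n → 0 < N ∸ i
  mirror-positive l = m<n⇒0<n∸m (s≤s l)

  mirror-sum : ∀ {i} → i ≤ 2 * n → i + (N ∸ i) ≡ N
  mirror-sum l = m+[n∸m]≡n (m≤n⇒m≤1+n l)

  mirror-≤ : ∀ {i} → 0 < i → N ∸ i ≤ 2 * n
  mirror-≤ {suc i} _ = m∸n≤m (2 * n) i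

  -- One label of each mirror pair is a row label, so the row labels and their mirror images exhaust
  -- the numbers from 1 to `2 * n`. Counting then gives exactly `n` rows.
  rows-and-columns : rowLabels ++ map (N ∸_) rowLabels ↭ applyUpTo suc (2 * n)
  rows-and-columns = unique-set⇒↭
    (Unique.++⁺ (AllPairs.map (λ { (l , _) → <⇒≢ l }) rowLabels-increasing)
      (AllPairs.map⁺ (AllPairs.map (λ { (l , b) e → <-irrefl
          (∸-cancelˡ-≡ (m≤n⇒m≤1+n (<⇒≤ (<-≤-trans l b))) (m≤n⇒m≤1+n b) e) l }) rowLabels-increasing))
      disjoint)
    (AllPairs.map (λ { (l , _) → <⇒≢ l }) labels-increasing)
    to from
    where
    disjoint : ∀ {i} → ¬ (i ∈ rowLabels × i ∈ map (N ∸_) rowLabels)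
    disjoint (i∈ , i∈') with ∈-map⁻ (N ∸_) i∈'
    ... | j , j∈ , refl with rowLabels⁻ j∈ | rowLabels⁻ i∈
    ...   | (0<j , j≤) , rj | (0<i , _) , ri = row-mirror 0<j 0<i (mirror-sum j≤) rj ri
    to : ∀ {i} → i ∈ rowLabels ++ map (N ∸_) rowLabels → i ∈ applyUpTo suc (2 * n)
    to i∈ with ∈-++⁻ rowLabels i∈
    ... | inj₁ i∈' = proj₁ (∈-filter⁻ row? i∈')
    ... | inj₂ i∈' with ∈-map⁻ (N ∸_) i∈'
    ...   | j , j∈ , refl with N ∸ j | mirror-positive (proj₂ (proj₁ (rowLabels⁻ j∈))) | mirror-≤
        (proj₁ (proj₁ (rowLabels⁻ j∈)))
    ...     | suc x | _ | l = ∈-applyUpTo⁺ suc l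
    from : ∀ {i} → i ∈ applyUpTo suc (2 * n) → i ∈ rowLabels ++ map (N ∸_) rowLabels
    from i∈ with ∈-applyUpTo⁻ suc i∈
    ... | x , l , refl with row? (suc x)
    ...   | yes r = ∈-++⁺ˡ (rowLabels⁺ z<s l r)
    ...   | no ¬r = ∈-++⁺ʳ rowLabels (subst (_∈ map (N ∸_) rowLabels) (m∸[m∸n]≡n (m≤n⇒m≤1+n l))
      (∈-map⁺ (N ∸_) (rowLabels⁺ (mirror-positive l) (mirror-≤ {suc x} z<s)
        (¬row-mirror z<s (mirror-positive l) (mirror-sum l) ¬r))))

  length-rowLabels : length rowLabels ≡ n
  length-rowLabels = *-cancelˡ-≡ (length rowLabels) n 2 (begin
    2 * length rowLabels ≡⟨ n+n≡2*n (length rowLabels) ⟨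
    length rowLabels + length rowLabels ≡⟨ cong (length rowLabels +_) (length-map (N ∸_) rowLabels) ⟨
    length rowLabels + length (map (N ∸_) rowLabels) ≡⟨ length-++ rowLabels ⟨
    length (rowLabels ++ map (N ∸_) rowLabels) ≡⟨ ↭-length rows-and-columns ⟩
    length (applyUpTo suc (2 * n)) ≡⟨ length-applyUpTo suc (2 * n) ⟩
    2 * n ∎)
    where open ≡-Reasoning

  r : ℕ → ℕ
  r = nth 0 rowLabels

  abstract
    r-properties : ∀ {a} → a < n → (0 < r a × r a ≤ 2 * n) × Row (r a)
    r-properties {a} a<n = rowLabels⁻ (nth-∈ 0 rowLabels a (subst (a <_) (sym length-rowLabels) a<n))

    r-increasing : ∀ {a b} → a < b → b < n → r a < r b
    r-increasing {a} {b} a<b b<n =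
      proj₁ (AllPairs-nth 0 rowLabels rowLabels-increasing a b a<b
          (subst (b <_) (sym length-rowLabels) b<n))

  r-positive : ∀ {a} → a < n → 0 < r a
  r-positive a<n = proj₁ (proj₁ (r-properties a<n))

  r-≤ : ∀ {a} → a < n → r a ≤ 2 * n
  r-≤ a<n = proj₂ (proj₁ (r-properties a<n))

  r-monotone : ∀ {a b} → a ≤ b → b < n → r a ≤ r b
  r-monotone a≤b b<n with m≤n⇒m<n∨m≡n a≤b
  ... | inj₁ a<b  = <⇒≤ (r-increasing a<b b<n)
  ... | inj₂ refl = ≤-refl

  -- Cell (a , c) exists iff the label of row a precedes the label N ∸ r c of column c.
  cell? : ∀ a c → Dec (a < n × c < n × r a + r c ≤ 2 * n)
  cell? a c = (a <? n) ×-dec (c <? n) ×-dec (r a + r c ≤? 2 * n)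

  S : ℕ → ℕ → Bool
  S a c = does (cell? a c)

  abstract
    S⁺ : ∀ {a c} → a < n → c < n → r a + r c ≤ 2 * n → S a c ≡ true
    S⁺ {a} {c} p q l = dec-true (cell? a c) (p , q , l)

    S⁻ : ∀ {a c} → S a c ≡ true → a < n × c < n × r a + r c ≤ 2 * n
    S⁻ {a} {c} = does-true (cell? a c)

  S-down : DownClosed S
  S-down {a} {b} {a'} {b'} a'≤a b'≤b s with S⁻ {a} {b} s
  ... | a<n , b<n , l = S⁺ {a'} {b'} (≤-<-trans a'≤a a<n) (≤-<-trans b'≤b b<n)
    (≤-trans (+-mono-≤ (r-monotone a'≤a a<n) (r-monotone b'≤b b<n)) l)

  S-bounded : ∀ {a b} → S a b ≡ true → a < n × b < n
  S-bounded {a} {b} s with S⁻ {a} {b} s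
  ... | a<n , b<n , _ = a<n , b<n

  S-mirror : ∀ {a b} → S a b ≡ true → S b a ≡ true
  S-mirror {a} {b} s with S⁻ {a} {b} s
  ... | a<n , b<n , l = S⁺ {b} {a} b<n a<n (subst (_≤ 2 * n) (+-comm (r a) (r b)) l)

  L : Wire → ℕ
  L (hwire a) = r a
  L (vwire c) = N ∸ r c

  L-positive : ∀ w → InBox n w → 0 < L w
  L-positive (hwire a) a<n = r-positive a<n
  L-positive (vwire c) c<n = mirror-positive (r-≤ c<n)

  L-≤ : ∀ w → InBox n w → L w ≤ 2 * n
  L-≤ (hwire a) a<n = r-≤ a<n
  L-≤ (vwire c) c<n = mirror-≤ (r-positive c<n)

  column-notRow : ∀ c → c < n → ¬ Row (N ∸ r c)
  column-notRow c c<n = row-mirror (r-positive c<n) (mirror-positive (r-≤ c<n))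
    (mirror-sum (r-≤ c<n)) (proj₂ (r-properties c<n))

  L-isLabelling : IsLabelling n S L
  L-isLabelling = record
    { mono = λ {w} {w'} → mono w w' ; positive = λ {w} → L-positive w ; bounded = λ {w} → L-≤ w }
    where
    mono : ∀ w w' → InBox n w → InBox n w' → Precedes S w w' → L w < L w'
    mono (hwire a) (hwire b) _ b<n a<b = r-increasing a<b b<n
    mono (hwire a) (vwire c) _ _ s = m+n≤o⇒m≤o∸n (suc (r a)) (s≤s (proj₂ (proj₂ (S⁻ {a} {c} s))))
    mono (vwire c) (hwire a) c<n a<n s with <-cmp (N ∸ r c) (r a)
    ... | tri< l _ _ = l
    -- Equality would make a column label a row label.
    ... | tri≈ _ e _ = contradiction (subst Row (sym e) (proj₂ (r-properties a<n))) (column-notRow c c<n)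
    ... | tri> _ _ l = contradiction s (true≢false (S⁺ {a} {c} a<n c<n
      (s≤s⁻¹ (≤-trans (+-monoˡ-≤ (r c) l) (≤-reflexive (m∸n+n≡m (m≤n⇒m≤1+n (r-≤ c<n))))))))
    mono (vwire c) (vwire d) c<n _ d<c = ∸-monoʳ-< (r-increasing d<c c<n) (m≤n⇒m≤1+n (r-≤ c<n))

  module Lab = Labelling L-isLabelling

  L-mirror : ∀ w → InBox n w → L w + L (mirror w) ≡ N
  L-mirror (hwire a) a<n = mirror-sum (r-≤ a<n)
  L-mirror (vwire c) c<n = m∸n+n≡m (m≤n⇒m≤1+n (r-≤ c<n))

  row-weak-excedance : ∀ {i} → Row i → i ≤ p i
  row-weak-excedance (inj₁ l)       = <⇒≤ l
  row-weak-excedance (inj₂ (e , _)) = ≤-reflexive e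

  column-weak-deficiency : ∀ {i} → ¬ Row i → p i ≤ i
  column-weak-deficiency r = ≮⇒≥ (λ l → r (inj₁ l))

  inBox? : ∀ w → Dec (InBox n w)
  inBox? (hwire a) = a <? n
  inBox? (vwire b) = b <? n

  abstract
    σ-exists : ∀ e → InBox n e → ∃ λ w → InBox n w × p (L w) ≡ L e
    σ-exists e e∈ with surjective (L-positive e e∈) (L-≤ e e∈)
    ... | j , l , ej with Lab.surjective j l
    ...   | w , w∈ , ew = w , w∈ , trans (cong p ew) ej

    -- The inverse of `p` transported to wires, to match `origin`; outside the box the value is a
    -- default.
    σ : Wire → Wire
    σ e with inBox? e
    ... | yes e∈ = proj₁ (σ-exists e e∈)
    ... | no _   = e

    σ-spec : ∀ e → InBox n e → InBox n (σ e) × p (L (σ e)) ≡ L e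
    σ-spec e e∈ with inBox? e
    ... | yes e∈' = proj₂ (σ-exists e e∈')
    ... | no e∉   = contradiction e∈ e∉

  σ-unique : ∀ e w → InBox n e → InBox n w → p (L w) ≡ L e → σ e ≡ w
  σ-unique e w e∈ w∈ q with σ-spec e e∈
  ... | σ∈ , q' = Lab.injective σ∈ w∈ (injective (L-positive _ σ∈) (L-≤ _ σ∈) (L-positive w w∈)
      (L-≤ w w∈)
    (trans q' (sym q)))

  σ-injective : InjectiveOn n σ
  σ-injective e e' e∈ e'∈ eq = Lab.injective e∈ e'∈
    (trans (sym (proj₂ (σ-spec e e∈))) (trans (cong (p ∘ L) eq) (proj₂ (σ-spec e' e'∈))))

  σ-mirror : ∀ e → InBox n e → σ (mirror e) ≡ mirror (σ e)
  σ-mirror e e∈ with σ-spec e e∈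
  ... | σ∈ , q = σ-unique (mirror e) (mirror (σ e)) (mirror-inBox e e∈) (mirror-inBox (σ e) σ∈)
    (sum-determines (symmetric (L-positive _ σ∈) (L-positive _ (mirror-inBox (σ e) σ∈))
        (L-mirror (σ e) σ∈))
      (trans (cong (_+ L (mirror e)) q) (L-mirror e e∈)))

  -- By the definition of `Row`, a path starting on a row exits no earlier than it starts, and one
  -- starting on a column no later. As labels increase along the boundary, this bounds the index
  -- when start and exit are of the same kind, and places their crossing in `S` when they are not.
  σ-reach : ∀ e → InBox n e → Reach S e (σ e)
  σ-reach e e∈ with σ e | σ-spec e e∈
  ... | w | w∈ , q = go e w e∈ w∈ q
    where
    row≤ : ∀ a {x} → a < n → p (r a) ≡ x → r a ≤ x
    row≤ a a<n q = subst (r a ≤_) q (row-weak-excedance (proj₂ (r-properties a<n)))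
    col≥ : ∀ c {x} → c < n → p (N ∸ r c) ≡ x → x ≤ N ∸ r c
    col≥ c c<n q = subst (_≤ N ∸ r c) q (column-weak-deficiency (column-notRow c c<n))
    cell : ∀ {a c} → a < n → c < n → r a ≤ N ∸ r c → S a c ≡ true
    cell {a} {c} a<n c<n l = ¬-not λ s →
      <⇒≱ (IsLabelling.mono L-isLabelling {vwire c} {hwire a} c<n a<n s) l
    go : ∀ e w → InBox n e → InBox n w → p (L w) ≡ L e → Reach S e w
    go (hwire i) (hwire i') i<n i'<n q = ≮⇒≥ λ l → <⇒≱ (r-increasing l i'<n) (row≤ i' i'<n q)
    go (hwire i) (vwire j) i<n j<n q = cell i<n j<n (col≥ j j<n q)
    go (vwire j) (hwire i) j<n i<n q = cell i<n j<n (row≤ i i<n q)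
    go (vwire j) (vwire j') j<n j'<n q = ≮⇒≥ λ l →
      <⇒≱ (IsLabelling.mono L-isLabelling {vwire j'} {vwire j} j'<n j<n l) (col≥ j' j'<n q)

  private
    module R = Reconstruct n S (λ {a} {b} → S-down {a} {b}) (λ {a} {b} → S-bounded {a} {b})
        σ σ-injective σ-reach

  abstract
    M : ℕ → ℕ → Bool
    M = R.filling

    M-⊆ : M ⊆ S
    M-⊆ = R.filling-⊆

    M-le : LeFilling S M
    M-le = R.filling-le

    M-origin : ∀ e → InBox n e → origin M n e ≡ σ e
    M-origin (hwire a) = R.filling-hor a
    M-origin (vwire b) = R.filling-ver b

  open Paths S (λ {a} {b} → S-down {a} {b})

  M-mirror : ∀ {a b} → M a b ≡ true → M b a ≡ true
  M-mirror {a} {b} m with S-bounded {a} {b} (M-⊆ m)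
  ... | a<n , b<n = trans (LeFilling-unique n M (transpose M) M-⊆
      (λ {a} {b} m → S-mirror {b} {a} (M-⊆ m)) M-le
      transpose-le hor-exits ver-exits b a b<n a<n) m
    where
    transpose-le : LeFilling S (transpose M)
    transpose-le a b s z with M-le b a (S-mirror {a} {b} s) z
    ... | inj₁ h = inj₂ (trans (ver-mirror M a b) (cong mirror h))
    ... | inj₂ v = inj₁ (trans (hor-mirror M a b) (cong mirror v))
    hor-exits : ∀ a → a < n → hor M a n ≡ hor (transpose M) a n
    hor-exits a a<n = trans (M-origin (hwire a) a<n) (trans (σ-mirror (vwire a) a<n)
      (trans (cong mirror (sym (M-origin (vwire a) a<n))) (sym (hor-mirror M a n))))
    ver-exits : ∀ b → b < n → ver M n b ≡ ver (transpose M) n b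
    ver-exits b b<n = trans (M-origin (vwire b) b<n) (trans (σ-mirror (hwire b) b<n)
      (trans (cong mirror (sym (M-origin (hwire b) b<n))) (sym (ver-mirror M n b))))

  M-no-le : ∀ {a b a' b'} → S a b ≡ true → M a b ≡ false →
    a' < a → M a' b ≡ true → b' < b → ¬ M a b' ≡ true
  M-no-le {a} {b} {a'} {b'} s z a'<a e b'<b f with M-le a b s z
  ... | inj₁ h = true≢false f (hor-unturned M M-⊆ a b h b' b'<b)
  ... | inj₂ v = true≢false e (ver-unturned M M-⊆ a b v a' a'<a)

  -- Row `a` of `S` is cut off after the diagonal cell; T_s restores the rest by reflection.
  len : ℕ → ℕ
  len a = suc a ⊓ countB (S a) (upTo n)

  -- As the shape is symmetric, k is the side of its Durfee square.
  tableau : Tab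
  tableau = mkTab (countB (λ a → S a a) (upTo n)) (map (λ a → map (M a) (upTo (len a))) (upTo n))

  len⁺ : ∀ {a b} → S a b ≡ true → b ≤ a → b < len a
  len⁺ {a} {b} s b≤a = ⊓-pres-m< (s≤s b≤a) (countB-initial⁺ (S a) id n
      (λ t _ → S-down {a} {suc t} ≤-refl (n≤1+n t)) b (proj₂ (S-bounded {a} {b} s)) s)

  len⁻ : ∀ {a b} → b < len a → S a b ≡ true × b ≤ a
  len⁻ {a} {b} l = proj₂ (countB-initial⁻ (S a) id n (λ t _ → S-down {a} {suc t} ≤-refl (n≤1+n t)) b
      (<-≤-trans l (m⊓n≤n (suc a) _)))
    , s≤s⁻¹ (<-≤-trans l (m⊓n≤m (suc a) _))

  diagonal-initial : ∀ t → suc t < n → S (suc t) (suc t) ≡ true → S t t ≡ true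
  diagonal-initial t _ = S-down {suc t} {suc t} (n≤1+n t) (n≤1+n t)

  k⁺ : ∀ {a} → S a a ≡ true → a < k tableau
  k⁺ {a} s = countB-initial⁺ (λ a → S a a) id n diagonal-initial a (proj₁ (S-bounded {a} {a} s)) s

  k⁻ : ∀ {a} → a < k tableau → S a a ≡ true
  k⁻ {a} l = proj₂ (countB-initial⁻ (λ a → S a a) id n diagonal-initial a l)

  length-rows : length (rows tableau) ≡ n
  length-rows = trans (length-map _ (upTo n)) (length-applyUpTo id n)

  row≡ : ∀ {a} → a < n → row tableau a ≡ map (M a) (upTo (len a))
  row≡ {a} a<n = nth-map-applyUpTo [] _ id n a a<n

  rowLen≡ : ∀ {a} → a < n → rowLen tableau a ≡ len a
  rowLen≡ {a} a<n = trans (cong length (row≡ a<n)) (trans (length-map (M a) (upTo (len a)))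
      (length-applyUpTo id (len a)))

  rowLen⁺ : ∀ {a b} → S a b ≡ true → b ≤ a → b < rowLen tableau a
  rowLen⁺ {a} {b} s b≤a = subst (b <_) (sym (rowLen≡ (proj₁ (S-bounded {a} {b} s)))) (len⁺ s b≤a)

  rowLen⁻ : ∀ {a b} → b < rowLen tableau a → S a b ≡ true × b ≤ a
  rowLen⁻ {a} {b} l with a <? n
  ... | yes a<n = len⁻ (subst (b <_) (rowLen≡ a<n) l)
  ... | no a≮n  = contradiction
    (subst (b <_) (cong length (nth-default [] (rows tableau) a
        (subst (_≤ a) (sym length-rows) (≮⇒≥ a≮n)))) l) λ ()

  entry≡ : ∀ {a b} → b < rowLen tableau a → entry tableau a b ≡ M a b
  entry≡ {a} {b} l with rowLen⁻ {a} {b} l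
  ... | s , b≤a = trans (cong (λ xs → nth false xs b) (row≡ (proj₁ (S-bounded {a} {b} s))))
    (nth-map-applyUpTo false (M a) id (len a) b (len⁺ s b≤a))

  entry⁻ : ∀ {a b} → entry tableau a b ≡ true → M a b ≡ true × b ≤ a
  entry⁻ {a} {b} e = trans (sym (entry≡ {a} l)) e , proj₂ (rowLen⁻ {a} l)
    where
    l : b < rowLen tableau a
    l = ≰⇒> λ l → true≢false e (nth-default false (row tableau a) b l)

  entry⁺ : ∀ {a b} → M a b ≡ true → b ≤ a → b < rowLen tableau a × entry tableau a b ≡ true
  entry⁺ {a} {b} m b≤a = rowLen⁺ {a} (M-⊆ m) b≤a , trans (entry≡ {a} (rowLen⁺ {a} (M-⊆ m) b≤a)) m

  -- If column `j` were 0, its path would run straight and `N ∸ r j` would be a fixed point of `p`.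
  -- As `(j , j)` lies in `S`, `r j ≤ n`, so this fixed point exceeds `n` and is a row label by the
  -- tie-break, which a column label cannot be.
  column-nonempty : ∀ j → S j j ≡ true → ∃ λ b → M b j ≡ true
  column-nonempty j s with search (λ b → M b j) n
  ... | inj₁ (b , _ , m) = b , m
  ... | inj₂ none with S⁻ {j} {j} s
  ...   | j<n , _ , 2r≤2n = contradiction (column-notRow j j<n) λ notRow → notRow
      (inj₂ (sym fixed , n<q))
    where
    fixed : p (N ∸ r j) ≡ N ∸ r j
    fixed = subst (λ w → p (L w) ≡ N ∸ r j)
      (trans (sym (M-origin (vwire j) j<n)) (ver-start M n j none)) (proj₂ (σ-spec (vwire j) j<n))
    r≤n : r j ≤ n
    r≤n = ≮⇒≥ λ l → <⇒≱ (s≤s (≤-trans (≤-reflexive (sym (n+n≡2*n n))) (+-monoʳ-≤ n (n≤1+n n))))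
      (≤-trans (+-mono-≤ l l) 2r≤2n)
    n<q : n < N ∸ r j
    n<q = m+n≤o⇒m≤o∸n (suc n) (s≤s (≤-trans (+-monoʳ-≤ n r≤n) (≤-reflexive (n+n≡2*n n))))

  tableau-isPTB : IsPTB n tableau
  tableau-isPTB = record
    { nrows = length-rows
    ; k≤n = countB-≤ _ id n
    ; stair = λ a a<k → <-ext (λ b l → s≤s (proj₂ (rowLen⁻ {a} l)))
        (λ b l → rowLen⁺ {a} (S-down {a} {a} ≤-refl (s≤s⁻¹ l) (k⁻ a<k)) (s≤s⁻¹ l))
    ; Fbounded = λ a k≤a a<n → ≮⇒≥ λ l → Fbounded a k≤a (rowLen⁻ {a} l)
    ; Fdecr = λ a k≤a _ → ≮⇒≥ λ l → Fdecr a k≤a l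
    ; colOne = λ j j<k → colOne j (k⁻ j<k)
    ; noLe = λ { i j l z ((i' , i'<i , e) , (j' , j'<j , f)) →
        M-no-le (proj₁ (rowLen⁻ {i} l)) (trans (sym (entry≡ {i} l)) z) i'<i (proj₁ (entry⁻ {i'} e))
            j'<j (proj₁ (entry⁻ {i} f)) }
    -- A 1 to the left of a diagonal cell is mirrored above it, so condition (3) is an instance of
    -- condition (2) for the symmetric filling.
    ; diag = λ { i i<k z (j , j<i , e) → M-no-le (k⁻ i<k)
        (trans (sym (entry≡ {i} (rowLen⁺ {i} (k⁻ i<k) ≤-refl))) z)
        j<i (M-mirror (proj₁ (entry⁻ {i} e))) j<i (proj₁ (entry⁻ {i} e)) }
    }
    where
    Fbounded : ∀ a → k tableau ≤ a → ¬ (S a (k tableau) ≡ true × k tableau ≤ a)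
    Fbounded a k≤a (s , _) = <-irrefl refl (k⁺ (S-down {a} {k tableau} k≤a ≤-refl s))
    Fdecr : ∀ a → k tableau ≤ a → ¬ rowLen tableau a < rowLen tableau (suc a)
    Fdecr a k≤a l with rowLen⁻ {suc a} l
    ... | s , b≤1+a with m≤n⇒m<n∨m≡n b≤1+a
    ...   | inj₁ b<1+a = <-irrefl refl (rowLen⁺ {a} (S-down {suc a} (n≤1+n a) ≤-refl s) (s≤s⁻¹ b<1+a))
    -- The longer row would reach its diagonal cell, forcing `suc a < k tableau`.
    ...   | inj₂ e = <⇒≱ (k⁺ {suc a} (subst (λ b → S (suc a) b ≡ true) e s)) (m≤n⇒m≤1+n k≤a)
    colOne : ∀ j → S j j ≡ true → ∃ λ i → j < rowLen tableau i × entry tableau i j ≡ true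
    colOne j s with column-nonempty j s
    ... | b , m with j ≤? b
    ...   | yes j≤b = b , entry⁺ m j≤b
    -- The 1 found lies beyond the diagonal, above `(j , j)`, and its mirror image lies to the left
    -- of `(j , j)`. So this diagonal cell is a 1, and it belongs to column `j` of `tableau`.
    ...   | no j≰b = j , entry⁺ (¬-not λ z → M-no-le s z (≰⇒> j≰b) m (≰⇒> j≰b) (M-mirror m)) ≤-refl

  private module E = Exits n tableau tableau-isPTB

  inS≡S : ∀ a b → inS n tableau a b ≡ S a b
  inS≡S a b with a <? b
  ... | no a≮b = bool-ext
    (λ t → proj₁ (rowLen⁻ {a} (E.inS-low⁻ (≮⇒≥ a≮b) t)))
    (λ s → E.inS-low⁺ (rowLen⁺ {a} s (≮⇒≥ a≮b)))
  ... | yes a<b = bool-ext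
    (λ t → S-mirror {b} {a} (proj₁ (rowLen⁻ {b} (E.inS-high⁻ a<b t))))
    (λ s → E.inS-high⁺ a<b (rowLen⁺ {b} (S-mirror {a} {b} s) (<⇒≤ a<b)))

  label≡L : ∀ {w} → InBox n w → E.label w ≡ L w
  label≡L = labelling-unique record
    { mono = λ {w} {w'} i i' q → IsLabelling.mono E.label-isLabelling i i' (convert w w' q)
    ; positive = E.positive ; bounded = E.bounded } L-isLabelling
    where
    convert : ∀ w w' → Precedes S w w' → Precedes (inS n tableau) w w'
    convert (hwire a) (hwire b) q = q
    convert (hwire a) (vwire c) q = trans (inS≡S a c) q
    convert (vwire c) (hwire a) q = trans (inS≡S a c) q
    convert (vwire c) (vwire d) q = q

  fill≡M-low : ∀ a b → b ≤ a → E.fill a b ≡ M a b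
  fill≡M-low a b b≤a = bool-ext
    (λ e → proj₁ (entry⁻ {a} (E.fill-low⁻ b≤a e)))
    (λ m → trans (E.fill-low (proj₁ (entry⁺ m b≤a)) b≤a) (proj₂ (entry⁺ m b≤a)))

  fill≡M : ∀ a b → E.fill a b ≡ M a b
  fill≡M a b with ≤-total b a
  ... | inj₁ b≤a = fill≡M-low a b b≤a
  ... | inj₂ a≤b = trans (E.fill-symmetric a b) (trans (fill≡M-low b a a≤b) (bool-ext M-mirror M-mirror))

  tableau-path : ∀ i → i < 2 * n → pathExit n tableau (suc i) ≡ p (suc i)
  tableau-path i l with E.surjective i l
  ... | w , w∈ , ew with E.exit w w∈
  ...   | e , e∈ , ee , o = trans (cong E.π (sym ew)) (trans ee (trans (label≡L e∈)
    (trans (sym (proj₂ (σ-spec e e∈))) (cong p (trans (cong L σe≡w) (trans (sym (label≡L w∈)) ew))))))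
    where
    σe≡w : σ e ≡ w
    σe≡w = trans (sym (M-origin e e∈)) (trans (sym (origin-cong e)) o)
      where
      origin-cong : ∀ e → origin E.fill n e ≡ origin M n e
      origin-cong (hwire a) = hor-cong fill≡M a n
      origin-cong (vwire b) = ver-cong fill≡M n b

-- One-line notation and the bijection.

lookup-nth : ∀ {m} (v : Vec ℕ m) i → lookup v i ≡ nth 0 (toList v) (toℕ i)
lookup-nth (x ∷ v) Fin.zero    = refl
lookup-nth (x ∷ v) (Fin.suc i) = lookup-nth v i

-- `pred` passes from labels, counted from 1, to positions, counted from 0.
oneLine : ∀ {m} → Vec ℕ m → ℕ → ℕ
oneLine v i = nth 0 (toList v) (pred i)

isSP⇒symmetricPermutation : ∀ n (v : Vec ℕ (2 * n)) → IsSP n v → IsSymmetricPermutation n (oneLine v)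
isSP⇒symmetricPermutation n v sp = record
  { range = range ; injective = injective ; surjective = surjective ; symmetric = symmetric }
  where
  open IsSP sp
  length-v : length (toList v) ≡ 2 * n
  length-v = length-toList v
  perm' : toList v ↭ applyUpTo suc (2 * n)
  perm' = subst (toList v ↭_) (map-upTo suc (2 * n)) perm
  unique : Unique (toList v)
  unique = PermutationSetoid.Unique-resp-↭ (setoid ℕ) (↭⇒↭ₛ (↭-sym perm'))
    (Unique.applyUpTo⁺₁ suc (2 * n) (λ i<j _ e → <⇒≢ i<j (suc-injective e)))
  range : ∀ {i} → 0 < i → i ≤ 2 * n → 0 < oneLine v i × oneLine v i ≤ 2 * n
  range {suc j} _ l with ∈-applyUpTo⁻ suc (∈-resp-↭ perm'
      (nth-∈ 0 (toList v) j (subst (j <_) (sym length-v) l)))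
  ... | x , x< , e rewrite e = z<s , x<
  injective : ∀ {i j} → 0 < i → i ≤ 2 * n → 0 < j → j ≤ 2 * n → oneLine v i ≡ oneLine v j → i ≡ j
  injective {suc i} {suc j} _ l _ l' e with <-cmp i j
  ... | tri< i<j _ _ = contradiction e (AllPairs-nth 0 (toList v) unique i j i<j
      (subst (j <_) (sym length-v) l'))
  ... | tri≈ _ refl _ = refl
  ... | tri> _ _ j<i = contradiction (sym e) (AllPairs-nth 0 (toList v) unique j i j<i
      (subst (i <_) (sym length-v) l))
  surjective : ∀ {i} → 0 < i → i ≤ 2 * n → ∃ λ j → j < 2 * n × oneLine v (suc j) ≡ i
  surjective {suc i} _ l with ∈-nth 0 (toList v) (∈-resp-↭ (↭-sym perm') (∈-applyUpTo⁺ suc l))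
  ... | j , j< , e = j , subst (j <_) length-v j< , e
  symmetric : ∀ {i j} → 0 < i → 0 < j → i + j ≡ suc (2 * n) → oneLine v i + oneLine v j ≡ suc (2 * n)
  symmetric {suc i} {suc j} _ _ e = trans (sym (cong₂ _+_ (value i (Fin.toℕ-fromℕ< i<2n))
      (value j opposite≡j))) (symm I)
    where
    e' : suc i + j ≡ 2 * n
    e' = suc-injective (trans (sym (+-suc (suc i) j)) e)
    i<2n : i < 2 * n
    i<2n = subst (suc i ≤_) e' (m≤m+n (suc i) j)
    I : Fin (2 * n)
    I = fromℕ< i<2n
    value : ∀ x {J} → toℕ J ≡ x → lookup v J ≡ nth 0 (toList v) x
    value x {J} eq = trans (lookup-nth v J) (cong (nth 0 (toList v)) eq)
    opposite≡j : toℕ (opposite I) ≡ j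
    opposite≡j = trans (Fin.opposite-prop I) (trans (cong (λ x → 2 * n ∸ suc x) (Fin.toℕ-fromℕ< i<2n))
      (trans (cong (_∸ suc i) (sym e')) (m+n∸m≡n (suc i) j)))

ΦB-surjective : ∀ n (v : Vec ℕ (2 * n)) → IsSP n v → ∃ λ T → IsPTB n T × ΦB n T ≡ v
ΦB-surjective n v sp = tableau , tableau-isPTB , trans (tabulate-cong path) (tabulate∘lookup v)
  where
  open Surjectivity n (oneLine v) (isSP⇒symmetricPermutation n v sp)
  path : ∀ i → pathExit n tableau (suc (toℕ i)) ≡ lookup v i
  path i = trans (tableau-path (toℕ i) (Fin.toℕ<n i)) (sym (lookup-nth v i))

theorem3p3 : (n : ℕ) →
    (∀ T → IsPTB n T → IsSP n (ΦB n T)) ×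
    (∀ T T' → IsPTB n T → IsPTB n T' → ΦB n T ≡ ΦB n T' → T ≡ T') ×
    (∀ (π : Vec ℕ (2 * n)) → IsSP n π → ∃ λ T → IsPTB n T × ΦB n T ≡ π)
theorem3p3 n = ΦB-isSP n , ΦB-injective n , ΦB-surjective n
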